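{- Let $s,d$ be integers, both at least $2$, and define integers $e_1,\dots,e_s,v,k$ by $$e_1=d+1,\qquad e_i=d+\prod_{j=1}^{i-1}e_j\ \ (2\le i\le s),\qquad v=\prod_{j=1}^s e_j,\qquad k=1+\frac{v-1}{d}.$$ Let $\mathscr{P}=\prod_{i=1}^s\mathbb{Z}_{e_i}$, and let $G=S_{e_1}\wr\cdots\wr S_{e_s}$ be the stabiliser in $\mathrm{Sym}(\mathscr{P})$ of the chain of partitions $\mathscr{C}_0\prec\cdots\prec\mathscr{C}_s$ described in the context. Let $y_0=1$ and $y_i=1+\frac{k-1}{v-1}\left(\left(\prod_{j=1}^i e_j\right)-1\right)$ for $1\le i\le s$, let $$B=\left\{(\delta_1,\dots,\delta_s)\in\mathscr{P} : 0\le\delta_i\le\frac{y_i}{y_{i-1}}-1\text{ for }1\le i\le s\right\},$$ and let $\mathscr{D}=(\mathscr{P},B^G)$, where $B^G=\{B^g: g\in G\}$. Then $\mathscr{D}$ is a $G$-flag-transitive, $(G,s)$-chain-imprimitive $2$-$(v,k,\lambda)$ design with $\lambda=\frac{bk}{vd}$, where $b=\prod_{i=1}^s\binom{e_i}{y_i/y_{i-1}}^{k/y_i}$, and $y_i=\frac{e_{i+1}-1}{d}$ for all $i\in\{1,\dots,s-1\}$, and $y_s=k$.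
   Context: $\mathbb{Z}_e=\{0,1,\dots,e-1\}$. For $0\le i\le s$, $\mathscr{C}_i$ is the partition of $\mathscr{P}=\prod_{i=1}^s\mathbb{Z}_{e_i}$ in which two points lie in the same class iff their $j$-th coordinates agree for all $j>i$; so $\mathscr{C}_0$ is the partition into singletons, $\mathscr{C}_s=\{\mathscr{P}\}$, and each $\mathscr{C}_i$-class is a union of $e_i$ $\mathscr{C}_{i-1}$-classes. $S_{e_1}\wr\cdots\wr S_{e_s}$ (iterated wreath product) denotes the group of all permutations of $\mathscr{P}$ leaving invariant each of the partitions $\mathscr{C}_0,\dots,\mathscr{C}_s$. A $2$-$(v,k,\lambda)$ design is a pair $(\mathscr{P},\mathscr{B})$ with $|\mathscr{P}|=v$, $\mathscr{B}$ a nonempty set of $k$-subsets of $\mathscr{P}$ (blocks), such that any two distinct points lie in exactly $\lambda$ blocks. It is $G$-flag-transitive if $G$ is a group of automorphisms transitive on the flags, i.e. pairs $(\delta,B)$ with $\delta\in B\in\mathscr{B}$. It is $(G,s)$-chain-imprimitive if $G$ is a group of automorphisms which is transitive on $\mathscr{P}$ and leaves invariant each partition of the chain $\mathscr{C}_0\prec\cdots\prec\mathscr{C}_s$. -}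

module Defs where

open import Data.Fin.Base using (Fin; zero; suc; toℕ)
open import Data.List.Base using (tabulate)
open import Data.Nat.Base
  using (ℕ; zero; suc; _+_; _*_; _∸_; _^_; _/_; _≤_; _<_; z≤n; s≤s;
         NonZero; nonZero; >-nonZero)
open import Data.Nat.Combinatorics using (_C_)
open import Data.Nat.ListAction using (product)
open import Data.Nat.Properties using (≤-trans; m≤m+n; *-mono-≤; m<n⇒0<n∸m)
open import Data.Product.Base using (∃-syntax; _×_; _,_; proj₁)
open import Data.Unit.Base using (⊤)
open import Function.Base using (_∘_)
open import Function.Bundles using (Inverse; _↔_; _⇔_)
open import Function.Construct.Composition using (_↔-∘_)
open import Function.Construct.Identity using (↔-id)
open import Function.Construct.Symmetry using (↔-sym)
open import Level using (0ℓ; _⊔_)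
open import Relation.Binary.Bundles using (Setoid)
open import Relation.Binary.Core using (Rel)
open import Relation.Binary.Definitions using (_Respects_)
open import Relation.Binary.PropositionalEquality
  using (_≡_; _≢_; _≗_; setoid)
import Relation.Binary.Construct.On as On
open import Relation.Unary using (Pred; _∈_; _≐_; Satisfiable)
open import Relation.Unary.Relation.Binary.Equality using (≐-setoid)

-- The elements of Q, counted up to the equality of S (membership proofs
-- are not counted), are in bijection with Fin n.
HasSize : ∀ {a ℓ q} (S : Setoid a ℓ) → Pred (Setoid.Carrier S) q → ℕ →
          Set (a ⊔ ℓ ⊔ q)
HasSize S Q n =
  Inverse (setoid (Fin n)) (On.setoid S (proj₁ {B = Q}))

Sym : Set → Set
Sym P = P ↔ P

-- Subsets of P are predicates; two of them are the same subset iff _≐_.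
Subset : Set → Set₁
Subset P = Pred P 0ℓ

module _ {P : Set} where

  infixl 8 _^_ᵖ _^_ˢ

  _^_ᵖ : P → Sym P → P
  α ^ g ᵖ = Inverse.to g α

  _^_ˢ : Subset P → Sym P → Subset P
  (X ^ g ˢ) β = ∃[ α ] α ∈ X × α ^ g ᵖ ≡ β

  Orbit : Subset P → Pred (Sym P) 0ℓ → Pred (Subset P) 0ℓ
  Orbit X G Y = ∃[ g ] g ∈ G × Y ≐ X ^ g ˢ

  record IsPermutationGroup (G : Pred (Sym P) 0ℓ) : Set where
    field
      respects : ∀ {g h} → Inverse.to g ≗ Inverse.to h → g ∈ G → h ∈ G
      identity : ↔-id P ∈ G
      closed   : ∀ {g h} → g ∈ G → h ∈ G → g ↔-∘ h ∈ G
      inverse  : ∀ {g} → g ∈ G → ↔-sym g ∈ G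

  IsAutomorphism : Pred (Subset P) 0ℓ → Sym P → Set₁
  IsAutomorphism 𝓑 g = ∀ X → X ∈ 𝓑 ⇔ X ^ g ˢ ∈ 𝓑

  -- A partition is given by its equivalence relation.
  LeavesInvariant : Sym P → Rel P 0ℓ → Set
  LeavesInvariant g _∼_ = ∀ α β → α ∼ β ⇔ (α ^ g ᵖ) ∼ (β ^ g ᵖ)

  record IsGroupOfAutomorphisms (G : Pred (Sym P) 0ℓ)
                                (𝓑 : Pred (Subset P) 0ℓ) : Set₁ where
    field
      isPermutationGroup : IsPermutationGroup G
      automorphism       : ∀ {g} → g ∈ G → IsAutomorphism 𝓑 g

  record Is2Design (𝓑 : Pred (Subset P) 0ℓ) (v k l : ℕ) : Set₁ where
    field
      -- 𝓑 is a set of subsets, so it does not distinguish predicates that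
      -- define the same subset.
      respects  : 𝓑 Respects _≐_
      points    : Fin v ↔ P
      nonempty  : Satisfiable 𝓑
      blockSize : ∀ {X} → X ∈ 𝓑 → HasSize (setoid P) X k
      balanced  : ∀ {α β} → α ≢ β →
                  HasSize (≐-setoid P 0ℓ) (λ X → X ∈ 𝓑 × α ∈ X × β ∈ X) l

  record IsFlagTransitive (G : Pred (Sym P) 0ℓ)
                          (𝓑 : Pred (Subset P) 0ℓ) : Set₁ where
    field
      isGroupOfAutomorphisms : IsGroupOfAutomorphisms G 𝓑
      transitive : ∀ {α β X Y} → X ∈ 𝓑 → α ∈ X → Y ∈ 𝓑 → β ∈ Y →
                   ∃[ g ] g ∈ G × α ^ g ᵖ ≡ β × X ^ g ˢ ≐ Y

-- The coordinate called j = 1, …, s in the mathematics is indexed here by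
-- the element j - 1 of Fin s.  Tuples are used rather than functions
-- (j : Fin s) → Fin (e j), so that _≡_ is equality of all coordinates.
∏ℤ : ∀ {s} → (Fin s → ℕ) → Set
∏ℤ {zero}  e = ⊤
∏ℤ {suc s} e = Fin (e zero) × ∏ℤ (e ∘ suc)

coord : ∀ {s} (e : Fin s → ℕ) → ∏ℤ e → (j : Fin s) → Fin (e j)
coord e (x , _)  zero    = x
coord e (_ , xs) (suc j) = coord (e ∘ suc) xs j

-- i runs over 0, …, s.  The coordinates in positions greater than i,
-- counted from 1, are those with toℕ j ≥ i.
𝒞 : ∀ {s} (e : Fin s → ℕ) → Fin (suc s) → Rel (∏ℤ e) 0ℓ
𝒞 e i α β = ∀ j → toℕ i ≤ toℕ j → coord e α j ≡ coord e β j

Wreath : ∀ {s} (e : Fin s → ℕ) → Pred (Sym (∏ℤ e)) 0ℓ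
Wreath e g = ∀ i → LeavesInvariant g (𝒞 e i)

record IsChainImprimitive {s} (e : Fin s → ℕ) (G : Pred (Sym (∏ℤ e)) 0ℓ)
                          (𝓑 : Pred (Subset (∏ℤ e)) 0ℓ) : Set₁ where
  field
    isGroupOfAutomorphisms : IsGroupOfAutomorphisms G 𝓑
    transitive : ∀ α β → ∃[ g ] g ∈ G × α ^ g ᵖ ≡ β
    invariant  : ∀ {g} → g ∈ G → ∀ i → LeavesInvariant g (𝒞 e i)

-- All quotients below are rounded down; that they are exact
-- has to be established separately.
module Construction (s d : ℕ) (2≤s : 2 ≤ s) (2≤d : 2 ≤ d) where

  -- e₊₁ i is e_{i+1}, and ∏e i is e₁ ⋯ e_i.
  e₊₁ ∏e : ℕ → ℕ
  e₊₁ zero    = d + 1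
  e₊₁ (suc i) = d + ∏e (suc i)
  ∏e zero    = 1
  ∏e (suc i) = ∏e i * e₊₁ i

  v : ℕ
  v = ∏e s

  2≤e₊₁ : ∀ i → 2 ≤ e₊₁ i
  2≤e₊₁ zero    = ≤-trans 2≤d (m≤m+n d 1)
  2≤e₊₁ (suc i) = ≤-trans 2≤d (m≤m+n d (∏e (suc i)))

  1≤∏e : ∀ i → 1 ≤ ∏e i
  1≤∏e zero    = s≤s z≤n
  1≤∏e (suc i) = *-mono-≤ (1≤∏e i) (≤-trans (s≤s z≤n) (2≤e₊₁ i))

  2≤∏e : ∀ {i} → 1 ≤ i → 2 ≤ ∏e i
  2≤∏e {suc i} _ = *-mono-≤ (1≤∏e i) (2≤e₊₁ i)

  instance
    d-nonZero : NonZero d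
    d-nonZero = >-nonZero (≤-trans (s≤s z≤n) 2≤d)

    v∸1-nonZero : NonZero (v ∸ 1)
    v∸1-nonZero =
      >-nonZero (m<n⇒0<n∸m (2≤∏e (≤-trans (s≤s z≤n) 2≤s)))

  k : ℕ
  k = 1 + (v ∸ 1) / d

  -- The product is formed before dividing, since (k - 1) / (v - 1) is a
  -- proper fraction.
  y : ℕ → ℕ
  y zero      = 1
  y i@(suc _) = 1 + ((k ∸ 1) * (∏e i ∸ 1)) / (v ∸ 1)

  y-nonZero : ∀ i → NonZero (y i)
  y-nonZero zero    = nonZero
  y-nonZero (suc i) = nonZero

  -- For j = i - 1 this is y_i / y_{i-1}.
  ratio : ℕ → ℕ
  ratio j = (y (suc j) / y j) {{y-nonZero j}}

  b : ℕ
  b = product (tabulate {n = s} λ j →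
        (e₊₁ (toℕ j) C ratio (toℕ j)) ^ (k / y (suc (toℕ j))))

  e : Fin s → ℕ
  e j = e₊₁ (toℕ j)

  𝒫 : Set
  𝒫 = ∏ℤ e

  G : Pred (Sym 𝒫) 0ℓ
  G = Wreath e

  -- _<_ instead of _≤_ with ratio ∸ 1, which would truncate at 0.
  B : Subset 𝒫
  B δ = ∀ j → toℕ (coord e δ j) < ratio (toℕ j)

  B^G : Pred (Subset 𝒫) 0ℓ
  B^G = Orbit B G

-- The parameters satisfy e_i = d + E and y_i / y_{i-1} = 1 + E with E = e₁ ⋯ e_{i-1},
-- and d y_i = d - 1 + e₁ ⋯ e_i.  The image of B under an element of the wreath product
-- is built from the top coordinate down by choosing y_i / y_{i-1} of the e_i children of
-- every node already chosen; this counts the blocks.  A block through α contains β, where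
-- i is the last coordinate in which they differ, for a fraction
--   (r_i - 1) / (e_i - 1) · ∏_{j < i} r_j / e_j        (r_j = y_j / y_{j-1})
-- of the blocks through α, and this is 1 / d for every i.  Flags are permuted
-- transitively because products of transpositions in the single coordinates act
-- transitively on B while fixing it.
module Submission where

open import Defs
open import Data.Nat.Base using (ℕ; suc; _+_; _*_; _∸_; _≤_; _<_)
open import Data.Nat.Divisibility using (_∣_)
open import Data.Product.Base using (∃-syntax; _×_)
open import Relation.Binary.PropositionalEquality using (_≡_)

open import Data.Bool.Base using (true; false)
open import Data.Empty using (⊥; ⊥-elim)
open import Data.Fin.Base using (Fin; zero; suc; toℕ; fromℕ<; inject≤; punchIn; punchOut)
open import Data.Fin.Permutation
  using (Permutation; Permutation′; _⟨$⟩ʳ_; _⟨$⟩ˡ_; insert; remove; transpose;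
         insert-punchIn; punchIn-permute′; inverseʳ)
import Data.Fin.Permutation as Perm
import Data.Fin.Permutation.Components as PC
open import Data.Fin.Properties as Fin
  using (1↔⊤; +↔⊎; *↔×; punchIn-punchOut; toℕ-fromℕ<; toℕ-inject≤; toℕ-injective;
         toℕ<n; toℕ≤pred[n])
open import Data.List.Base using (tabulate)
open import Data.List.Properties using (tabulate-cong)
open import Data.Nat.Base
open import Data.Nat.Combinatorics using (_C_; nC1≡n; nCn≡1; nCk≡nC[n∸k]; nCk+nC[k+1]≡[n+1]C[k+1])
open import Data.Nat.Divisibility using (divides; ∣-refl; ∣-trans)
open import Data.Nat.DivMod using (m*n/n≡m; /-congˡ)
open import Data.Nat.ListAction using (product)
open import Data.Nat.Properties
open import Data.Nat.Tactic.RingSolver using (solve-∀)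
open import Data.Product.Base
open import Data.Product.Function.Dependent.Propositional using (Σ-↔)
open import Data.Product.Function.NonDependent.Propositional using (_×-↔_)
open import Data.Product.Properties using (≡-dec)
open import Data.Sum.Base using (_⊎_; inj₁; inj₂; [_,_]′)
open import Data.Sum.Function.Propositional using (_⊎-↔_)
open import Data.Unit.Base using (⊤; tt)
open import Data.Vec.Functional using (insertAt)
open import Data.Vec.Functional.Properties using (insertAt-punchIn)
open import Function.Base using (_∘_; const)
open import Function.Bundles
  using (_↔_; _⇔_; mk↔ₛ′; mk⇔; Inverse; Injection; Equivalence)
open import Function.Construct.Composition using (_↔-∘_)
import Function.Properties.Equivalence as ⇔
open import Function.Properties.Inverse using (↔-refl; ↔-sym; ↔-trans; ↔⇒↣)
open import Relation.Binary.Definitions using (DecidableEquality)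
open import Relation.Binary.PropositionalEquality
open import Relation.Nullary
open import Relation.Unary using (Pred; _∈_; _≐_)
import Relation.Unary.Properties as ≐
open import Relation.Unary.Relation.Binary.Equality using (≐-setoid)

open Equivalence using (to; from)

-- Enumerating labelled subsets, and binomial coefficients

resize : ∀ {m n} {A : Set} → m ≡ n → Fin m ↔ A → Fin n ↔ A
resize {A = A} m≡n = subst (λ k → Fin k ↔ A) m≡n

empty-↔ : {A : Set} → ¬ A → Fin 0 ↔ A
empty-↔ ¬a = mk↔ₛ′ (λ ()) (⊥-elim ∘ ¬a) (⊥-elim ∘ ¬a) λ ()

-- An r-subset of Fin n whose elements carry labels in A.
data Selection (A : Set) : ℕ → ℕ → Set where
  []   : Selection A 0 0
  _∷_  : ∀ {n r} → A → Selection A n r → Selection A (suc n) (suc r)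
  skip : ∀ {n r} → Selection A n r → Selection A (suc n) r

Selects : ∀ {A : Set} {n r} → (A → Set) → Selection A n r → Fin n → Set
Selects F (a ∷ c)  zero    = F a
Selects F (a ∷ c)  (suc x) = Selects F c x
Selects F (skip c) zero    = ⊥
Selects F (skip c) (suc x) = Selects F c x

Σ-skip-↔ : ∀ {A : Set} {n} {P : Selection A (suc n) 0 → Set} →
           Σ (Selection A n 0) (P ∘ skip) ↔ Σ (Selection A (suc n) 0) P
Σ-skip-↔ = mk↔ₛ′ (λ { (c , p) → skip c , p }) (λ { (skip c , p) → c , p })
                 (λ { (skip c , p) → refl }) (λ { (c , p) → refl })

Σ-∷-skip-↔ : ∀ {A : Set} {n r} {P : Selection A (suc n) (suc r) → Set} →
             (Σ (A × Selection A n r) (λ { (a , c) → P (a ∷ c) }) ⊎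
              Σ (Selection A n (suc r)) (P ∘ skip)) ↔
             Σ (Selection A (suc n) (suc r)) P
Σ-∷-skip-↔ = mk↔ₛ′
  [ (λ { ((a , c) , p) → a ∷ c , p }) , (λ { (c , p) → skip c , p }) ]′
  (λ { (a ∷ c , p) → inj₁ ((a , c) , p) ; (skip c , p) → inj₂ (c , p) })
  (λ { (a ∷ c , p) → refl ; (skip c , p) → refl })
  (λ { (inj₁ _) → refl ; (inj₂ _) → refl })

nC0≡1 : ∀ n → n C 0 ≡ 1
nC0≡1 n = trans (nCk≡nC[n∸k] {0} {n} z≤n) (nCn≡1 n)

¬selects-0 : ∀ {A : Set} {F : A → Set} {n} (c : Selection A n 0) x → ¬ Selects F c x
¬selects-0 (skip c) (suc x) = ¬selects-0 c x

¬selects-1 : ∀ {A : Set} {F H : A → Set} {n} (c : Selection A n 1) {x y} → x ≢ y →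
             ¬ (Selects F c x × Selects H c y)
¬selects-1 (a ∷ c) {zero}  {zero}  x≢y _       = x≢y refl
¬selects-1 (a ∷ c) {_}     {suc y} x≢y (_ , q) = ¬selects-0 c y q
¬selects-1 (a ∷ c) {suc x} {_}     x≢y (p , _) = ¬selects-0 c x p
¬selects-1 (skip c) {suc x} {suc y} x≢y pq     = ¬selects-1 c (x≢y ∘ cong suc) pq

module _ {A : Set} {a : ℕ} (A-↔ : Fin a ↔ A) where

  -- Pascal's rule as a bijection: a selection either selects 0 or skips it. `P` is arbitrary
  -- because the counts below all go through this step.
  ⊎-∷-skip : ∀ {n r m₁ m₂ m} {P : Selection A (suc n) (suc r) → Set} →
             m₁ + m₂ ≡ m →
             Fin m₁ ↔ Σ (A × Selection A n r) (λ { (a , c) → P (a ∷ c) }) →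
             Fin m₂ ↔ Σ (Selection A n (suc r)) (P ∘ skip) →
             Fin m ↔ Σ (Selection A (suc n) (suc r)) P
  ⊎-∷-skip eq ∷-↔ skip-↔ =
    resize eq (↔-trans +↔⊎ (↔-trans (∷-↔ ⊎-↔ skip-↔) Σ-∷-skip-↔))

  tail-↔ : ∀ {n r m} {P : Selection A n r → Set} →
          Fin m ↔ Σ (Selection A n r) P →
          Fin (a * m) ↔ Σ (A × Selection A n r) (P ∘ proj₂)
  tail-↔ ↔m = ↔-trans *↔× (↔-trans (A-↔ ×-↔ ↔m)
    (mk↔ₛ′ (λ { (a , c , p) → (a , c) , p }) (λ { ((a , c) , p) → a , c , p })
      (λ _ → refl) (λ _ → refl)))

  selection-↔ : ∀ n r → Fin ((n C r) * a ^ r) ↔ Selection A n r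
  selection-↔ n r = ↔-trans (go n r) Σ⊤
    where
    Σ⊤ : ∀ {B : Set} → Σ B (λ _ → ⊤) ↔ B
    Σ⊤ = mk↔ₛ′ proj₁ (_, tt) (λ _ → refl) (λ _ → refl)

    -- The trivial predicate gives the count the Σ form that `⊎-∷-skip` produces.
    go : ∀ n r → Fin ((n C r) * a ^ r) ↔ Σ (Selection A n r) (λ _ → ⊤)
    go zero zero = ↔-trans 1↔⊤ (mk↔ₛ′ (λ _ → [] , tt) (λ _ → tt) (λ { ([] , tt) → refl }) (λ _ → refl))
    go zero (suc r) = empty-↔ λ ()
    go (suc n) zero = resize (cong (_* 1) (trans (nC0≡1 n) (sym (nC0≡1 (suc n))))) (↔-trans (go n 0) Σ-skip-↔)
    go (suc n) (suc r) =
      ⊎-∷-skip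
        (trans (identity a (n C r) (n C suc r) (a ^ r))
               (cong (_* a ^ suc r) (nCk+nC[k+1]≡[n+1]C[k+1] n r)))
        (tail-↔ (go n r)) (go n (suc r))
      where
      identity : ∀ a p q t → a * (p * t) + q * (a * t) ≡ (p + q) * (a * t)
      identity = solve-∀

  module _ {F : A → Set} {f : ℕ} (F-↔ : Fin f ↔ Σ A F) where

    head-↔ : ∀ {n r m} {P : Selection A n r → Set} → Fin m ↔ Σ (Selection A n r) P → 
             Fin (f * m) ↔ Σ (A × Selection A n r) (λ { (a , c) → F a × P c })
    head-↔ ↔m = ↔-trans *↔× (↔-trans (F-↔ ×-↔ ↔m)
      (mk↔ₛ′ (λ { ((a , q) , c , p) → (a , c) , q , p }) (λ { ((a , c) , q , p) → (a , q) , c , p })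
        (λ _ → refl) (λ _ → refl)))

    -- The label of `x` has `f` possible values, while the other `r` points are chosen and labelled
    -- freely among the remaining `n`. Pascal's rule moves `x` down to 0, where this is immediate.
    selecting-↔ : ∀ n r (x : Fin (suc n)) →
      Fin (f * ((n C r) * a ^ r)) ↔
      Σ (Selection A (suc n) (suc r)) (λ c → Selects F c x)
    selecting-↔ n r zero = 
      ⊎-∷-skip (+-identityʳ _)
        (↔-trans *↔× (↔-trans (F-↔ ×-↔ selection-↔ n r)
          (mk↔ₛ′ (λ { ((a , q) , c) → (a , c) , q }) (λ { ((a , c) , q) → (a , q) , c })
            (λ _ → refl) (λ _ → refl))))
        (empty-↔ proj₂)
    selecting-↔ (suc n) zero (suc x) = 
      ⊎-∷-skip (cong (λ z → f * (z * 1)) (trans (nC0≡1 n) (sym (nC0≡1 (suc n)))))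
        (empty-↔ λ { ((_ , c) , p) → ¬selects-0 c x p })
        (selecting-↔ n 0 x)
    selecting-↔ (suc n) (suc r) (suc x) = 
      ⊎-∷-skip
        (trans (identity a (n C r) (n C suc r) (a ^ r) f)
               (cong (λ z → f * (z * a ^ suc r)) (nCk+nC[k+1]≡[n+1]C[k+1] n r)))
        (tail-↔ (selecting-↔ n r x)) (selecting-↔ n (suc r) x)
      where
      identity : ∀ a p q t f → a * (f * (p * t)) + f * (q * (a * t)) ≡ f * ((p + q) * (a * t))
      identity = solve-∀

module _ {A : Set} {a : ℕ} (A-↔ : Fin a ↔ A)
         {F H : A → Set} {f h : ℕ} (F-↔ : Fin f ↔ Σ A F) (H-↔ : Fin h ↔ Σ A H) where

  -- As soon as one of the points is 0, it is stripped off and `selecting-↔` handles the other;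
  -- until then Pascal's rule lowers both.
  selecting₂-↔ : ∀ n r {x y : Fin (2 + n)} → x ≢ y →
    Fin (f * (h * ((n C r) * a ^ r))) ↔
    Σ (Selection A (2 + n) (2 + r)) (λ c → Selects F c x × Selects H c y)
  selecting₂-↔ n r {zero}  {zero}  x≢y = contradiction refl x≢y
  selecting₂-↔ n r {zero}  {suc y} x≢y =
    ⊎-∷-skip A-↔ (+-identityʳ _) (head-↔ A-↔ F-↔ (selecting-↔ A-↔ H-↔ n r y)) (empty-↔ (proj₁ ∘ proj₂))
  selecting₂-↔ n r {suc x} {zero}  x≢y =
    ⊎-∷-skip A-↔ (trans (+-identityʳ _) (identity f h _))
      (↔-trans (head-↔ A-↔ H-↔ (selecting-↔ A-↔ F-↔ n r x))
        (mk↔ₛ′ (λ { (c , p) → c , swap p }) (λ { (c , p) → c , swap p }) (λ _ → refl) (λ _ → refl)))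
      (empty-↔ (proj₂ ∘ proj₂))
    where
    identity : ∀ f h t → h * (f * t) ≡ f * (h * t)
    identity = solve-∀
  selecting₂-↔ zero r {suc zero} {suc zero} x≢y = contradiction refl x≢y
  selecting₂-↔ (suc n) zero {suc x} {suc y} x≢y =
    ⊎-∷-skip A-↔ (cong (λ z → f * (h * (z * 1))) (trans (nC0≡1 n) (sym (nC0≡1 (suc n)))))
      -- Only two points are selected in all, so 0 cannot be a third one.
      (empty-↔ λ { ((_ , c) , p) → ¬selects-1 c (x≢y ∘ cong suc) p })
      (selecting₂-↔ n 0 (x≢y ∘ cong suc))
  selecting₂-↔ (suc n) (suc r) {suc x} {suc y} x≢y =
    ⊎-∷-skip A-↔
      (trans (identity a (n C r) (n C suc r) (a ^ r) f h)
             (cong (λ z → f * (h * (z * a ^ suc r))) (nCk+nC[k+1]≡[n+1]C[k+1] n r)))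
      (tail-↔ A-↔ (selecting₂-↔ n r (x≢y ∘ cong suc)))
      (selecting₂-↔ n (suc r) (x≢y ∘ cong suc))
    where
    identity : ∀ a p q t f h →
      a * (f * (h * (p * t))) + f * (h * (q * (a * t))) ≡ f * (h * ((p + q) * (a * t)))
    identity = solve-∀

-- Both sides count the pairs of a (k+1)-subset and one of its elements. This turns the counts above
-- into fractions of all selections.
C-absorb : ∀ n k → suc k * (suc n C suc k) ≡ suc n * (n C k)
C-absorb zero    zero    = refl
C-absorb zero    (suc k) = *-zeroʳ k
C-absorb (suc n) zero    = trans (*-identityˡ _) (trans (nC1≡n (2 + n))
  (trans (sym (*-identityʳ _)) (cong ((2 + n) *_) (sym (nC0≡1 (suc n))))))
C-absorb (suc n) (suc k) = begin
  (2 + k) * (N C (2 + k))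
    ≡⟨ cong ((2 + k) *_) (nCk+nC[k+1]≡[n+1]C[k+1] (suc n) (suc k)) ⟨
  (2 + k) * (suc n C suc k + suc n C (2 + k))
    ≡⟨ split k (suc n C suc k) (suc n C (2 + k)) ⟩
  suc n C suc k + (suc k * (suc n C suc k) + (2 + k) * (suc n C (2 + k)))
    ≡⟨ cong₂ (λ p q → suc n C suc k + (p + q)) (C-absorb n k) (C-absorb n (suc k)) ⟩
  suc n C suc k + (suc n * (n C k) + suc n * (n C suc k))
    ≡⟨ cong (suc n C suc k +_) (*-distribˡ-+ (suc n) (n C k) (n C suc k)) ⟨
  suc n C suc k + suc n * (n C k + n C suc k)
    ≡⟨ cong (λ z → suc n C suc k + suc n * z) (nCk+nC[k+1]≡[n+1]C[k+1] n k) ⟩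
  N * (suc n C suc k) ∎
  where
  open ≡-Reasoning
  N = 2 + n
  split : ∀ k p q → (2 + k) * (p + q) ≡ p + (suc k * p + (2 + k) * q)
  split = solve-∀

0<nCk : ∀ {n k} → k ≤ n → 0 < n C k
0<nCk {n} {zero} _ = ≤-reflexive (sym (nC0≡1 n))
0<nCk {suc n} {suc k} (s≤s k≤n) =
  <-≤-trans (0<nCk k≤n) (≤-trans (m≤m+n _ _) (≤-reflexive (nCk+nC[k+1]≡[n+1]C[k+1] n k)))

-- Counting the blocks through one point and through two points

∏ : ∀ {s} → (Fin s → ℕ) → ℕ
∏ {zero}  e = 1
∏ {suc s} e = e zero * ∏ (e ∘ suc)

∏ℤ-↔ : ∀ {s} (e : Fin s → ℕ) → Fin (∏ e) ↔ ∏ℤ e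
∏ℤ-↔ {zero}  e = 1↔⊤
∏ℤ-↔ {suc s} e = ↔-trans *↔× (↔-refl ×-↔ ∏ℤ-↔ (e ∘ suc))

∏ℤ-≟ : ∀ {s} (e : Fin s → ℕ) → DecidableEquality (∏ℤ e)
∏ℤ-≟ {zero}  e _ _ = yes refl
∏ℤ-≟ {suc s} e = ≡-dec Fin._≟_ (∏ℤ-≟ (e ∘ suc))

-- A block whose points carry labels in A.  Since ∏ℤ splits off the lowest coordinate,
-- a block is a block in the remaining coordinates labelled by selections of values of
-- the lowest one.
Labelled : ∀ {s} (e r : Fin s → ℕ) → Set → Set
Labelled {zero}  e r A = A
Labelled {suc s} e r A = Labelled (e ∘ suc) (r ∘ suc) (Selection A (e zero) (r zero))

-- p belongs to X and its label satisfies F.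
Hit : ∀ {s} (e r : Fin s → ℕ) {A : Set} → (A → Set) → Labelled e r A → ∏ℤ e → Set
Hit {zero}  e r F X _       = F X
Hit {suc s} e r F X (x , p) = Hit (e ∘ suc) (r ∘ suc) (λ c → Selects F c x) X p

Selects-× : ∀ {A : Set} {F H K : A → Set} → (∀ a → K a ↔ (F a × H a)) →
            ∀ {n r} (c : Selection A n r) x → Selects K c x ↔ (Selects F c x × Selects H c x)
Selects-× K-↔ (a ∷ c)  zero    = K-↔ a
Selects-× K-↔ (a ∷ c)  (suc x) = Selects-× K-↔ c x
Selects-× K-↔ (skip c) zero    = mk↔ₛ′ (λ ()) proj₁ (λ ()) (λ ())
Selects-× K-↔ (skip c) (suc x) = Selects-× K-↔ c x

-- Merges two tests at the same point into one. A bijection is needed, not just an equivalence,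
-- because counts are transported along it.
Hit-× : ∀ {s} (e r : Fin s → ℕ) {A : Set} {F H K : A → Set} → (∀ a → K a ↔ (F a × H a)) →
        ∀ X p → Hit e r K X p ↔ (Hit e r F X p × Hit e r H X p)
Hit-× {zero}  e r K-↔ X _       = K-↔ X
Hit-× {suc s} e r K-↔ X (x , p) = Hit-× (e ∘ suc) (r ∘ suc) (λ c → Selects-× K-↔ c x) X p

#labelled : ∀ {s} (e r : Fin s → ℕ) → ℕ → ℕ
#labelled {zero}  e r a = a
#labelled {suc s} e r a = #labelled (e ∘ suc) (r ∘ suc) ((e zero C r zero) * a ^ r zero)

Bounds : ∀ {s} (e r : Fin s → ℕ) → Set
Bounds e r = ∀ j → 2 ≤ r j × r j ≤ e j

-- The sizes are fractions of a total; they are left existential and pinned down by cross-multiplied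
-- equations, which avoids division.
CountWith : Set → (ℕ → Set) → Set
CountWith A E = ∃[ m ] (Fin m ↔ A) × E m

module _ {A : Set} {a : ℕ} (A-↔ : Fin a ↔ A) {F : A → Set} {f : ℕ} (F-↔ : Fin f ↔ Σ A F) where

  -- The fraction of selections that qualify is (r / n) (f / a), by one absorption.
  selecting-count : ∀ n r → 2 ≤ r → (x : Fin n) →
    CountWith (Σ (Selection A n r) (λ c → Selects F c x)) λ m →
      m * (n * a) ≡ ((n C r) * a ^ r) * (r * f)
  selecting-count (suc n) (suc r) _ x = _ , selecting-↔ A-↔ F-↔ n r x , (begin
    (f * ((n C r) * t)) * (suc n * a)   ≡⟨ lhs f (n C r) t (suc n) a ⟩
    f * (t * a) * (suc n * (n C r))     ≡⟨ cong (f * (t * a) *_) (C-absorb n r) ⟨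
    f * (t * a) * (suc r * (suc n C suc r)) ≡⟨ rhs f t a (suc r) (suc n C suc r) ⟩
    ((suc n C suc r) * (a * t)) * (suc r * f) ∎)
    where
    open ≡-Reasoning
    t = a ^ r
    lhs : ∀ f c t n a → (f * (c * t)) * (n * a) ≡ f * (t * a) * (n * c)
    lhs = solve-∀
    rhs : ∀ f t a r c → f * (t * a) * (r * c) ≡ (c * (a * t)) * (r * f)
    rhs = solve-∀

  module _ {H : A → Set} {h : ℕ} (H-↔ : Fin h ↔ Σ A H) where

    -- The fraction is r (r - 1) / (n (n - 1)) times f h / a², by one absorption for each point.
    selecting₂-count : ∀ n r → 2 ≤ r → {x y : Fin n} → x ≢ y →
      CountWith (Σ (Selection A n r) (λ c → Selects F c x × Selects H c y)) λ m →
        m * ((n ∸ 1) * n * (a * a)) ≡ ((n C r) * a ^ r) * ((r ∸ 1) * r * (f * h))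
    selecting₂-count 1 r _ {zero} {zero} x≢y = contradiction refl x≢y
    selecting₂-count (suc (suc n)) (suc (suc r)) (s≤s (s≤s _)) x≢y =
      _ , selecting₂-↔ A-↔ F-↔ H-↔ n r x≢y , (begin
      (f * (h * ((n C r) * t))) * (suc n * (2 + n) * (a * a))
        ≡⟨ lhs f h (n C r) t (suc n) (2 + n) a ⟩
      f * h * t * a * a * ((2 + n) * (suc n * (n C r)))
        ≡⟨ cong (λ z → f * h * t * a * a * ((2 + n) * z)) (C-absorb n r) ⟨
      f * h * t * a * a * ((2 + n) * (suc r * (suc n C suc r)))
        ≡⟨ mid (f * h * t * a * a) (2 + n) (suc r) (suc n C suc r) ⟩
      f * h * t * a * a * (suc r * ((2 + n) * (suc n C suc r)))
        ≡⟨ cong (λ z → f * h * t * a * a * (suc r * z)) (C-absorb (suc n) (suc r)) ⟨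
      f * h * t * a * a * (suc r * ((2 + r) * ((2 + n) C (2 + r))))
        ≡⟨ rhs f h t a (suc r) (2 + r) ((2 + n) C (2 + r)) ⟩
      (((2 + n) C (2 + r)) * (a * (a * t))) * (suc r * (2 + r) * (f * h)) ∎)
      where
      open ≡-Reasoning
      t = a ^ r
      lhs : ∀ f h c t n′ n a → (f * (h * (c * t))) * (n′ * n * (a * a)) ≡ f * h * t * a * a * (n * (n′ * c))
      lhs = solve-∀
      mid : ∀ z n r c → z * (n * (r * c)) ≡ z * (r * (n * c))
      mid = solve-∀
      rhs : ∀ f h t a r′ r c → f * h * t * a * a * (r′ * (r * c)) ≡ (c * (a * (a * t))) * (r′ * r * (f * h))
      rhs = solve-∀

labels-positive : ∀ {n r a} → r ≤ n → 0 < a → 0 < (n C r) * a ^ r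
labels-positive {n} {r} {a} r≤n 0<a = *-mono-≤ (0<nCk r≤n) (m^n>0 a {{>-nonZero 0<a}} r)

-- Each coordinate contributes a factor r_j / e_j: `selecting-count` converts the test on labels
-- into a test on selections, which are the labels at the next level.
hit-count : ∀ {s} (e r : Fin s → ℕ) → Bounds e r →
  ∀ {A : Set} {a} → 0 < a → Fin a ↔ A → ∀ {F : A → Set} {f} → Fin f ↔ Σ A F → ∀ p →
  CountWith (Σ (Labelled e r A) (λ X → Hit e r F X p)) λ m →
    m * (∏ e * a) ≡ #labelled e r a * (∏ r * f)
hit-count {zero} e r _ {a = a} 0<a A-↔ {f = f} F-↔ _ = f , F-↔ , identity f a
  where
  identity : ∀ f a → f * (1 * a) ≡ a * (1 * f)
  identity = solve-∀
hit-count {suc s} e r bounds {a = a} 0<a A-↔ {f = f} F-↔ (x , p) =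
  let f′ , F′-↔ , f′-eq = selecting-count A-↔ F-↔ n k (proj₁ (bounds zero)) x
      m , ↔m , m-eq = hit-count (e ∘ suc) (r ∘ suc) (bounds ∘ suc) 0<a′ (selection-↔ A-↔ n k) F′-↔ p
  -- Both equations are relative to `a′`, the number of labels at the next level; it is positive
  -- because r ≤ e.
  in m , ↔m , *-cancelʳ-≡ _ _ a′ {{>-nonZero 0<a′}} (begin
    m * (n * v * a) * a′            ≡⟨ lhs m n v a a′ ⟩
    m * (v * a′) * (n * a)          ≡⟨ cong (_* (n * a)) m-eq ⟩
    M * (K * f′) * (n * a)          ≡⟨ mid M K f′ (n * a) ⟩
    M * K * (f′ * (n * a))          ≡⟨ cong (M * K *_) f′-eq ⟩
    M * K * (a′ * (k * f))          ≡⟨ rhs M K a′ k f ⟩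
    M * (k * K * f) * a′            ∎)
  where
  open ≡-Reasoning
  n = e zero
  k = r zero
  v = ∏ (e ∘ suc)
  K = ∏ (r ∘ suc)
  a′ = (n C k) * a ^ k
  M = #labelled (e ∘ suc) (r ∘ suc) a′
  0<a′ : 0 < a′
  0<a′ = labels-positive {n} {k} (proj₂ (bounds zero)) 0<a
  lhs : ∀ m n v a a′ → m * (n * v * a) * a′ ≡ m * (v * a′) * (n * a)
  lhs = solve-∀
  mid : ∀ M K f z → M * (K * f) * z ≡ M * K * (f * z)
  mid = solve-∀
  rhs : ∀ M K a′ k f → M * K * (a′ * (k * f)) ≡ M * (k * K * f) * a′
  rhs = solve-∀

-- α and β are the products of the r_j and of the e_j over the coordinates already split off.
Balance : ∀ {s} (d α β : ℕ) (e r : Fin s → ℕ) → Set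
Balance {zero}  d α β e r = ⊤
Balance {suc s} d α β e r =
  α * (r zero ∸ 1) * d ≡ β * (e zero ∸ 1) ×
  Balance d (α * r zero) (β * e zero) (e ∘ suc) (r ∘ suc)

-- The fraction of labelled blocks is (∏ r / ∏ e) (β / (α d)) (f h / a²), whichever coordinate is
-- the last to separate `p` from `q`.
hit₂-count : ∀ {s} (d α β : ℕ) (e r : Fin s → ℕ) → Bounds e r → Balance d α β e r →
  ∀ {A : Set} {a} → 0 < a → Fin a ↔ A →
  ∀ {F H : A → Set} {f h} → Fin f ↔ Σ A F → Fin h ↔ Σ A H → ∀ {p q} → p ≢ q →
  CountWith (Σ (Labelled e r A) (λ X → Hit e r F X p × Hit e r H X q)) λ m →
    m * (∏ e * (α * d * (a * a))) ≡ #labelled e r a * (∏ r * (β * (f * h)))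
hit₂-count {zero} d α β e r _ _ _ _ _ _ p≢q = contradiction refl p≢q
hit₂-count {suc s} d α β e r bounds (balance , balances) {a = a} 0<a A-↔ {f = f} {h} F-↔ H-↔
           {x , p} {y , q} xp≢yq
  with ∏ℤ-≟ (e ∘ suc) p q
-- The lowest remaining coordinate is the last one that differs. Both points lie in one fibre, so
-- the two tests become a single test on the selection at `p`.
... | yes refl =
  let f′ , F′-↔ , f′-eq = selecting₂-count A-↔ F-↔ H-↔ n k (proj₁ (bounds zero)) (xp≢yq ∘ cong (_, p))
      m , ↔m , m-eq = hit-count (e ∘ suc) (r ∘ suc) (bounds ∘ suc) 0<a′ (selection-↔ A-↔ n k) F′-↔ p
  in m , ↔-trans ↔m (Σ-↔ ↔-refl (λ {X} → Hit-× (e ∘ suc) (r ∘ suc) (λ _ → ↔-refl) X p))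
    , *-cancelʳ-≡ _ _ z {{>-nonZero 0<z}} (begin
    m * (n * v * (α * d * (a * a))) * (a′ * n′)        ≡⟨ lhs m n v (α * d) (a * a) a′ n′ ⟩
    m * (v * a′) * (n′ * n * (a * a)) * (α * d)        ≡⟨ cong (λ t → t * (n′ * n * (a * a)) * (α * d)) m-eq ⟩
    M * (K * f′) * (n′ * n * (a * a)) * (α * d)        ≡⟨ mid M K f′ _ (α * d) ⟩
    M * K * (f′ * (n′ * n * (a * a))) * (α * d)        ≡⟨ cong (λ t → M * K * t * (α * d)) f′-eq ⟩
    M * K * (a′ * (k′ * k * (f * h))) * (α * d)        ≡⟨ mid₂ M K a′ k′ k (f * h) α d ⟩
    -- The balance equation makes the result independent of which coordinate is the last to differ.
    M * K * a′ * k * (f * h) * (α * k′ * d)            ≡⟨ cong (M * K * a′ * k * (f * h) *_) balance ⟩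
    M * K * a′ * k * (f * h) * (β * n′)                ≡⟨ rhs M K a′ k (f * h) β n′ ⟩
    M * (k * K * (β * (f * h))) * (a′ * n′)            ∎)
  where
  open ≡-Reasoning
  n = e zero
  k = r zero
  n′ = n ∸ 1
  k′ = k ∸ 1
  v = ∏ (e ∘ suc)
  K = ∏ (r ∘ suc)
  a′ = (n C k) * a ^ k
  M = #labelled (e ∘ suc) (r ∘ suc) a′
  0<a′ : 0 < a′
  0<a′ = labels-positive {n} {k} (proj₂ (bounds zero)) 0<a
  z = a′ * n′
  0<z : 0 < z
  0<z = *-mono-≤ 0<a′ (m<n⇒0<n∸m (≤-trans (proj₁ (bounds zero)) (proj₂ (bounds zero))))
  lhs : ∀ m n v α a² a′ n′ → m * (n * v * (α * a²)) * (a′ * n′) ≡ m * (v * a′) * (n′ * n * a²) * α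
  lhs = solve-∀
  mid : ∀ M K f z w → M * (K * f) * z * w ≡ M * K * (f * z) * w
  mid = solve-∀
  mid₂ : ∀ M K a′ k′ k f α d → M * K * (a′ * (k′ * k * f)) * (α * d) ≡ M * K * a′ * k * f * (α * k′ * d)
  mid₂ = solve-∀
  rhs : ∀ M K a′ k f β n′ → M * K * a′ * k * f * (β * n′) ≡ M * (k * K * (β * f)) * (a′ * n′)
  rhs = solve-∀
-- Each point contributes r / e in this coordinate. One of these factors joins ∏ r / ∏ e, the other
-- offsets the e / r by which β / α is multiplied.
... | no p≢q =
  let f′ , F′-↔ , f′-eq = selecting-count A-↔ F-↔ n k (proj₁ (bounds zero)) x
      h′ , H′-↔ , h′-eq = selecting-count A-↔ H-↔ n k (proj₁ (bounds zero)) y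
      m , ↔m , m-eq = hit₂-count d (α * k) (β * n) (e ∘ suc) (r ∘ suc) (bounds ∘ suc) balances
                        0<a′ (selection-↔ A-↔ n k) F′-↔ H′-↔ p≢q
  in m , ↔m , *-cancelʳ-≡ _ _ z {{>-nonZero 0<z}} (begin
    m * (n * v * (α * d * (a * a))) * (k * n * (a′ * a′))   ≡⟨ lhs m n v (α) d a k a′ ⟩
    m * (v * (α * k * d * (a′ * a′))) * ((n * a) * (n * a)) ≡⟨ cong (_* ((n * a) * (n * a))) m-eq ⟩
    M * (K * (β * n * (f′ * h′))) * ((n * a) * (n * a))     ≡⟨ mid M K (β * n) f′ h′ (n * a) ⟩
    M * K * (β * n) * ((f′ * (n * a)) * (h′ * (n * a)))     ≡⟨ cong₂ (λ t u → M * K * (β * n) * (t * u)) f′-eq h′-eq ⟩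
    M * K * (β * n) * ((a′ * (k * f)) * (a′ * (k * h)))     ≡⟨ rhs M K β n a′ k f h ⟩
    M * (k * K * (β * (f * h))) * (k * n * (a′ * a′))       ∎)
  where
  open ≡-Reasoning
  n = e zero
  k = r zero
  v = ∏ (e ∘ suc)
  K = ∏ (r ∘ suc)
  a′ = (n C k) * a ^ k
  M = #labelled (e ∘ suc) (r ∘ suc) a′
  0<a′ : 0 < a′
  0<a′ = labels-positive {n} {k} (proj₂ (bounds zero)) 0<a
  0<k : 0 < k
  0<k = <⇒≤ (proj₁ (bounds zero))
  z = k * n * (a′ * a′)
  0<z : 0 < z
  0<z = *-mono-≤ (*-mono-≤ 0<k (≤-trans 0<k (proj₂ (bounds zero)))) (*-mono-≤ 0<a′ 0<a′)
  lhs : ∀ m n v α d a k a′ →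
    m * (n * v * (α * d * (a * a))) * (k * n * (a′ * a′)) ≡
    m * (v * (α * k * d * (a′ * a′))) * ((n * a) * (n * a))
  lhs = solve-∀
  mid : ∀ M K β f h n → M * (K * (β * (f * h))) * (n * n) ≡ M * K * β * ((f * n) * (h * n))
  mid = solve-∀
  rhs : ∀ M K β n a′ k f h →
    M * K * (β * n) * ((a′ * (k * f)) * (a′ * (k * h))) ≡
    M * (k * K * (β * (f * h))) * (k * n * (a′ * a′))
  rhs = solve-∀

-- The number of all labelled blocks

^-distribˡ-* : ∀ k m n → (m * n) ^ k ≡ m ^ k * n ^ k
^-distribˡ-* zero    m n = refl
^-distribˡ-* (suc k) m n =
  trans (cong (m * n *_) (^-distribˡ-* k m n)) (identity m n (m ^ k) (n ^ k))
  where
  identity : ∀ m n p q → m * n * (p * q) ≡ (m * p) * (n * q)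
  identity = solve-∀

-- A block has `∏ r` points, each carrying one of `a` labels independently of which points they are.
#labelled-closed : ∀ {s} (e r : Fin s → ℕ) a → #labelled e r a ≡ a ^ ∏ r * #labelled e r 1
#labelled-closed {zero} e r a = sym (trans (*-identityʳ _) (*-identityʳ a))
#labelled-closed {suc s} e r a = begin
  #labelled e′ r′ (c * a ^ k)              ≡⟨ #labelled-closed e′ r′ _ ⟩
  (c * a ^ k) ^ K * M                      ≡⟨ cong (_* M) (^-distribˡ-* K c (a ^ k)) ⟩
  c ^ K * (a ^ k) ^ K * M                  ≡⟨ cong (λ z → c ^ K * z * M) (^-*-assoc a k K) ⟩
  c ^ K * a ^ (k * K) * M                  ≡⟨ cong (_* M) (*-comm (c ^ K) _) ⟩
  a ^ (k * K) * c ^ K * M                  ≡⟨ *-assoc (a ^ (k * K)) (c ^ K) M ⟩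
  a ^ (k * K) * (c ^ K * M)                ≡⟨ cong (λ z → a ^ (k * K) * (z ^ K * M)) (*-identityʳ c) ⟨
  a ^ (k * K) * ((c * 1) ^ K * M)          ≡⟨ cong (λ z → a ^ (k * K) * ((c * z) ^ K * M)) (^-zeroˡ k) ⟨
  a ^ (k * K) * ((c * 1 ^ k) ^ K * M)      ≡⟨ cong (a ^ (k * K) *_) (#labelled-closed e′ r′ _) ⟨
  a ^ (k * K) * #labelled e′ r′ (c * 1 ^ k) ∎
  where
  open ≡-Reasoning
  e′ = e ∘ suc
  r′ = r ∘ suc
  k = r zero
  c = e zero C k
  K = ∏ r′
  M = #labelled e′ r′ 1

-- The wreath product, one coordinate at a time

coord-ext : ∀ {s} (e : Fin s → ℕ) {α β} → (∀ j → coord e α j ≡ coord e β j) → α ≡ β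
coord-ext {zero}  e _  = refl
coord-ext {suc s} e eq = cong₂ _,_ (eq zero) (coord-ext (e ∘ suc) (eq ∘ suc))

𝒞-zero : ∀ {s} (e : Fin s → ℕ) {α β} → 𝒞 e zero α β ⇔ α ≡ β
𝒞-zero e = mk⇔ (λ eq → coord-ext e (λ j → eq j z≤n)) (λ { refl _ _ → refl })

𝒞-suc : ∀ {s} (e : Fin (suc s) → ℕ) i {α β} → 𝒞 e (suc i) α β ⇔ 𝒞 (e ∘ suc) i (proj₂ α) (proj₂ β)
𝒞-suc e i = mk⇔ (λ eq j i≤j → eq (suc j) (s≤s i≤j)) (λ { eq zero () ; eq (suc j) (s≤s i≤j) → eq j i≤j })

wreath-isPermutationGroup : ∀ {s} (e : Fin s → ℕ) → IsPermutationGroup (Wreath e)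
wreath-isPermutationGroup e = record
  { respects = λ g≗h g∈G i α β →
      subst₂ (λ γ δ → 𝒞 e i α β ⇔ 𝒞 e i γ δ) (g≗h α) (g≗h β) (g∈G i α β)
  ; identity = λ _ _ _ → ⇔.refl
  ; closed = λ {g} {h} g∈G h∈G i α β → ⇔.trans (h∈G i α β) (g∈G i _ _)
  ; inverse = λ {g} g∈G i α β →
      subst₂ (λ γ δ → 𝒞 e i γ δ ⇔ 𝒞 e i (Inverse.from g α) (Inverse.from g β))
             (Inverse.strictlyInverseˡ g α) (Inverse.strictlyInverseˡ g β)
             (⇔.sym (g∈G i _ _))
  }

infixr 5 _⋉_

-- The fibre over `p` is carried by `h p` onto the fibre over the image of `p`. Since `h` is indexed
-- by the source, the inverse looks it up at the preimage of `q`.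
_⋉_ : ∀ {A P : Set} → (P → Sym A) → Sym P → Sym (A × P)
h ⋉ g = mk↔ₛ′
  (λ { (x , p) → Inverse.to (h p) x , Inverse.to g p })
  (λ { (y , q) → Inverse.from (h (Inverse.from g q)) y , Inverse.from g q })
  (λ { (y , q) → cong₂ _,_ (Inverse.strictlyInverseˡ (h (Inverse.from g q)) y) (Inverse.strictlyInverseˡ g q) })
  (λ { (x , p) → trans (cong (λ p′ → Inverse.from (h p′) (Inverse.to (h p) x) , p′) (Inverse.strictlyInverseʳ g p))
                       (cong (_, p) (Inverse.strictlyInverseʳ (h p) x)) })

-- 𝒞₀ is equality, which every bijection keeps; the coarser partitions see only the tail, where `g`
-- acts.
⋉-∈-Wreath : ∀ {s} (e : Fin (suc s) → ℕ) h {g} → g ∈ Wreath (e ∘ suc) → (h ⋉ g) ∈ Wreath e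
⋉-∈-Wreath e h {g} _ zero α β =
  ⇔.trans (𝒞-zero e) (⇔.trans
    (mk⇔ (cong (Inverse.to (h ⋉ g))) (Injection.injective (↔⇒↣ (h ⋉ g))))
    (⇔.sym (𝒞-zero e)))
⋉-∈-Wreath e h g∈W (suc i) (_ , p) (_ , q) = ⇔.trans (𝒞-suc e i) (⇔.trans (g∈W i p q) (⇔.sym (𝒞-suc e i)))

-- In the other direction, a permutation that respects equality of tails has the form
-- `fibre ⋉ base`. The point `a` picks a representative of each fibre; by invariance the tail of the
-- image does not depend on it.
module Decompose {A P : Set} (g : Sym (A × P))
  (invariant : ∀ {α β} → proj₂ α ≡ proj₂ β ⇔ proj₂ (Inverse.to g α) ≡ proj₂ (Inverse.to g β))
  (a : A) where

  private
    module g = Inverse g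
    invariant⁻¹ : ∀ {α β} → proj₂ α ≡ proj₂ β → proj₂ (g.from α) ≡ proj₂ (g.from β)
    invariant⁻¹ {α} {β} eq = from invariant
      (trans (cong proj₂ (g.strictlyInverseˡ α)) (trans eq (cong proj₂ (sym (g.strictlyInverseˡ β)))))

  base : Sym P
  base = mk↔ₛ′ (λ p → proj₂ (g.to (a , p))) (λ q → proj₂ (g.from (a , q)))
    (λ q → trans (to invariant refl) (cong proj₂ (g.strictlyInverseˡ (a , q))))
    (λ p → trans (invariant⁻¹ refl) (cong proj₂ (g.strictlyInverseʳ (a , p))))

  fibre : P → Sym A
  fibre p = mk↔ₛ′ (λ x → proj₁ (g.to (x , p))) (λ y → proj₁ (g.from (y , q)))
    (λ y → trans (cong (λ p′ → proj₁ (g.to (proj₁ (g.from (y , q)) , p′))) (sym (back y)))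
                 (cong proj₁ (g.strictlyInverseˡ (y , q))))
    (λ x → trans (cong (λ q′ → proj₁ (g.from (proj₁ (g.to (x , p)) , q′))) (to invariant refl))
                 (cong proj₁ (g.strictlyInverseʳ (x , p))))
    where
    q = Inverse.to base p
    back : ∀ y → proj₂ (g.from (y , q)) ≡ p
    back y = trans (invariant⁻¹ refl) (Inverse.strictlyInverseʳ base p)

  decompose : ∀ α → g.to α ≡ Inverse.to (fibre ⋉ base) α
  decompose (x , p) = cong (proj₁ (g.to (x , p)) ,_) (to invariant refl)

-- Labelled blocks as images of the box, determined by their points

Box : ∀ {s} (e r : Fin s → ℕ) → Subset (∏ℤ e)
Box e r δ = ∀ j → toℕ (coord e δ j) < r j

-- The support of c is the image under σ of {0, …, r - 1}, and the label of σ x is ℓ x.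
Represents : ∀ {A : Set} {n r} → Permutation′ n → (Fin n → A) → Selection A n r → Set₁
Represents {A} {n} {r} σ ℓ c = ∀ (F : A → Set) x → Selects F c (σ ⟨$⟩ʳ x) ⇔ (toℕ x < r × F (ℓ x))

-- Deleting `i` from an initial segment that contains it shortens the segment by one; `punchIn-≥-<`
-- covers an `i` beyond the segment, which then stays as it is.
punchIn-≤-< : ∀ {n} (i : Fin (suc n)) j {r} → toℕ i ≤ r → toℕ (punchIn i j) < suc r ⇔ toℕ j < r
punchIn-≤-< zero    j       _         = mk⇔ s<s⁻¹ s<s
punchIn-≤-< (suc i) zero    (s≤s _)   = mk⇔ (const z<s) (const z<s)
punchIn-≤-< (suc i) (suc j) (s≤s i≤r) = mk⇔
  (s<s ∘ to (punchIn-≤-< i j i≤r) ∘ s<s⁻¹)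
  (s<s ∘ from (punchIn-≤-< i j i≤r) ∘ s<s⁻¹)

punchIn-≥-< : ∀ {n} (i : Fin (suc n)) j {r} → r ≤ toℕ i → toℕ (punchIn i j) < r ⇔ toℕ j < r
punchIn-≥-< zero    j       z≤n       = mk⇔ (λ ()) (λ ())
punchIn-≥-< (suc i) j       z≤n       = mk⇔ (λ ()) (λ ())
punchIn-≥-< (suc i) zero    (s≤s _)   = ⇔.refl
punchIn-≥-< (suc i) (suc j) (s≤s r≤i) = mk⇔
  (s<s ∘ to (punchIn-≥-< i j r≤i) ∘ s<s⁻¹)
  (s<s ∘ from (punchIn-≥-< i j r≤i) ∘ s<s⁻¹)

-- `τ` is `σ` with `i` and its image 0 deleted. Hence 0 is selected exactly when `i` lies in the
-- initial segment, and the other points follow `τ`.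
module _ {A : Set} {n r : ℕ} (σ : Permutation′ (suc n)) (τ : Permutation′ n)
         (ℓ : Fin (suc n) → A) {ℓ′ : Fin n → A}
         (i : Fin (suc n)) (σi≡0 : σ ⟨$⟩ʳ i ≡ zero)
         (σ-punchIn : ∀ j → σ ⟨$⟩ʳ punchIn i j ≡ suc (τ ⟨$⟩ʳ j))
         (ℓ-punchIn : ∀ j → ℓ (punchIn i j) ≡ ℓ′ j) where

  represents-∷ : {c : Selection A n r} → toℕ i ≤ r → Represents τ ℓ′ c → Represents σ ℓ (ℓ i ∷ c)
  represents-∷ {c} i≤r rep F x with i Fin.≟ x
  ... | yes refl rewrite σi≡0 = mk⇔ (s≤s i≤r ,_) proj₂
  ... | no i≢x = subst (λ y → Selects F (ℓ i ∷ c) (σ ⟨$⟩ʳ y) ⇔ (toℕ y < suc r × F (ℓ y)))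
                       (punchIn-punchOut i≢x) at-punchIn
    where
    j = punchOut i≢x
    at-punchIn : Selects F (ℓ i ∷ c) (σ ⟨$⟩ʳ punchIn i j) ⇔
                 (toℕ (punchIn i j) < suc r × F (ℓ (punchIn i j)))
    at-punchIn rewrite σ-punchIn j | ℓ-punchIn j = mk⇔
      (map₁ (from (punchIn-≤-< i j i≤r)) ∘ to (rep F j))
      (from (rep F j) ∘ map₁ (to (punchIn-≤-< i j i≤r)))

  represents-skip : {c : Selection A n r} → r ≤ toℕ i → Represents τ ℓ′ c → Represents σ ℓ (skip c)
  represents-skip {c} r≤i rep F x with i Fin.≟ x
  ... | yes refl rewrite σi≡0 = mk⇔ ⊥-elim (λ (i<r , _) → <⇒≱ i<r r≤i)
  ... | no i≢x = subst (λ y → Selects F (skip c) (σ ⟨$⟩ʳ y) ⇔ (toℕ y < r × F (ℓ y)))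
                       (punchIn-punchOut i≢x) at-punchIn
    where
    j = punchOut i≢x
    at-punchIn : Selects F (skip c) (σ ⟨$⟩ʳ punchIn i j) ⇔
                 (toℕ (punchIn i j) < r × F (ℓ (punchIn i j)))
    at-punchIn rewrite σ-punchIn j | ℓ-punchIn j = mk⇔
      (map₁ (from (punchIn-≥-< i j r≤i)) ∘ to (rep F j))
      (from (rep F j) ∘ map₁ (to (punchIn-≥-< i j r≤i)))

insert-at : ∀ {m n} i j (π : Permutation m n) → insert i j π ⟨$⟩ʳ i ≡ j
insert-at i j π with i Fin.≟ i
... | yes _  = refl
... | no i≢i = contradiction refl i≢i

size≤ : ∀ {A : Set} {n r} → Selection A n r → r ≤ n
size≤ []       = z≤n
size≤ (_ ∷ c)  = s≤s (size≤ c)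
size≤ (skip c) = m≤n⇒m≤1+n (size≤ c)

-- The element of A serves as the label of the points that are not selected.
permutation-of : ∀ {A : Set} → A → ∀ {n r} (c : Selection A n r) →
                 ∃₂ λ σ ℓ → Represents σ ℓ c
permutation-of a [] = Perm.id , const a , λ F ()
permutation-of a (b ∷ c) =
  let τ , ℓ , rep = permutation-of a c in
  -- A selected 0 must come from the initial segment, and index 0 always lies in it.
  insert zero zero τ , insertAt ℓ zero b ,
  represents-∷ (insert zero zero τ) τ (insertAt ℓ zero b) zero (insert-at zero zero τ)
    (insert-punchIn zero zero τ) (insertAt-punchIn ℓ zero b) z≤n rep
permutation-of a {suc n} {r} (skip c) =
  let τ , ℓ , rep = permutation-of a c in
  -- A skipped 0 must come from outside the initial segment; `r` is the first such index, and it
  -- exists because `r ≤ n`.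
  insert i zero τ , insertAt ℓ i a ,
  represents-skip (insert i zero τ) τ (insertAt ℓ i a) i (insert-at i zero τ)
    (insert-punchIn i zero τ) (insertAt-punchIn ℓ i a) (≤-reflexive (sym (toℕ-fromℕ< r<1+n))) rep
  where
  r<1+n : r < suc n
  r<1+n = s≤s (size≤ c)
  i = fromℕ< r<1+n

-- The image is read off from 0 upwards: 0 is selected when its preimage is below `r`, and then both
-- are removed from `σ`.
selection-of : ∀ {A : Set} {n r} → r ≤ n → (σ : Permutation′ n) (ℓ : Fin n → A) →
               Σ (Selection A n r) (Represents σ ℓ)
selection-of {n = zero} {zero} _ σ ℓ = [] , λ F ()
selection-of {n = suc n} {r} r≤1+n σ ℓ with toℕ (σ ⟨$⟩ˡ zero) <? r
selection-of {n = suc n} {suc r} (s≤s r≤n) σ ℓ | yes i<1+r =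
  let i = σ ⟨$⟩ˡ zero
      c , rep = selection-of r≤n (remove i σ) (ℓ ∘ punchIn i)
  in ℓ i ∷ c , represents-∷ σ (remove i σ) ℓ i (inverseʳ σ) (punchIn-permute′ σ zero)
                 (λ _ → refl) (s≤s⁻¹ i<1+r) rep
... | no i≮r =
  let i = σ ⟨$⟩ˡ zero
      r≤i = ≮⇒≥ i≮r
      -- The preimage of 0 is at most `n` and not below `r`, so `r ≤ n` still holds.
      c , rep = selection-of {n = n} (≤-trans r≤i (toℕ≤pred[n] i)) (remove i σ) (ℓ ∘ punchIn i)
  in skip c , represents-skip σ (remove i σ) ℓ i (inverseʳ σ) (punchIn-permute′ σ zero)
                (λ _ → refl) r≤i rep

-- The analogue of `Represents` for all coordinates. Ranging over every test `F` lets the induction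
-- substitute a `Selects` test for it.
Encodes : ∀ {s} (e r : Fin s → ℕ) {A : Set} → Sym (∏ℤ e) → (∏ℤ e → A) → Labelled e r A → Set₁
Encodes e r {A} g ℓ X = ∀ (F : A → Set) p → Hit e r F X (p ^ g ᵖ) ⇔ (p ∈ Box e r × F (ℓ p))

encodes-⋉ : ∀ {s} (e r : Fin (suc s) → ℕ) {A : Set} h g (ℓ : ∏ℤ e → A) {ℓ′ X} →
            Encodes (e ∘ suc) (r ∘ suc) g ℓ′ X → (∀ p → Represents (h p) (λ x → ℓ (x , p)) (ℓ′ p)) →
            Encodes e r (h ⋉ g) ℓ X
encodes-⋉ e r h g ℓ {ℓ′} enc rep F (x , p) = ⇔.trans (enc _ p) (mk⇔
  (λ { (p∈ , hit) → let x< , Fℓ = to (rep p F x) hit in (λ { zero → x< ; (suc j) → p∈ j }) , Fℓ })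
  (λ { (xp∈ , Fℓ) → xp∈ ∘ suc , from (rep p F x) (xp∈ zero , Fℓ) }))

-- The labels of the block in the upper coordinates are selections; each is realised by a
-- permutation of the fibre over its point.
permutation-encoded : ∀ {s} (e r : Fin s → ℕ) → Bounds e r → ∀ {A : Set} → A → (X : Labelled e r A) →
  Σ[ g ∈ Sym (∏ℤ e) ] g ∈ Wreath e × ∃[ ℓ ] Encodes e r g ℓ X
permutation-encoded {zero} e r _ a X =
  ↔-refl , IsPermutationGroup.identity (wreath-isPermutationGroup e) , const X , λ F p → mk⇔ ((λ ()) ,_) proj₂
permutation-encoded {suc s} e r bounds a X =
  -- A default selection, since the recursive call needs an element of its label type.
  let c , _ = selection-of (proj₂ (bounds zero)) Perm.id (const a)
      g , g∈W , ℓ′ , enc = permutation-encoded (e ∘ suc) (r ∘ suc) (bounds ∘ suc) c X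
      h p = proj₁ (permutation-of a (ℓ′ p))
      ℓ = λ { (x , p) → proj₁ (proj₂ (permutation-of a (ℓ′ p))) x }
  in h ⋉ g , ⋉-∈-Wreath e h {g} g∈W , ℓ ,
     encodes-⋉ e r h g ℓ enc (λ p → proj₂ (proj₂ (permutation-of a (ℓ′ p))))

-- Each fibre permutation of `g` yields a selection, and these selections label the block obtained
-- from `base`.
encode : ∀ {s} (e r : Fin s → ℕ) → Bounds e r → ∀ {A : Set} g → g ∈ Wreath e → (ℓ : ∏ℤ e → A) →
         Σ (Labelled e r A) (Encodes e r g ℓ)
encode {zero} e r _ g _ ℓ = ℓ tt , λ F p → mk⇔ ((λ ()) ,_) proj₂
encode {suc s} e r bounds g g∈W ℓ =
  let ℓ′ p = selection-of (proj₂ (bounds zero)) (fibre p) (λ x → ℓ (x , p))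
      X , enc = encode (e ∘ suc) (r ∘ suc) (bounds ∘ suc) base base∈W (proj₁ ∘ ℓ′)
  in X , λ F p → subst (λ q → Hit e r F X q ⇔ (p ∈ Box e r × F (ℓ p))) (sym (decompose p))
                   (encodes-⋉ e r fibre base ℓ enc (proj₂ ∘ ℓ′) F p)
  where
  origin : Fin (e zero)
  origin = fromℕ< (≤-trans (<⇒≤ (proj₁ (bounds zero))) (proj₂ (bounds zero)))
  -- Respecting equality of tails is invariance of 𝒞₁.
  open Decompose g (⇔.trans (⇔.sym (𝒞-zero (e ∘ suc))) (⇔.trans (⇔.sym (𝒞-suc e zero))
    (⇔.trans (g∈W (suc zero) _ _) (⇔.trans (𝒞-suc e zero) (𝒞-zero (e ∘ suc)))))) origin
  base∈W : base ∈ Wreath (e ∘ suc)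
  base∈W i p q = ⇔.trans (⇔.sym (𝒞-suc e i)) (⇔.trans (g∈W (suc i) (origin , p) (origin , q)) (𝒞-suc e i))

-- A family of tests on labels determines labels; it then also determines labelled
-- blocks, tested at every point, because every label passes some test and so the
-- absence of a label is detected.
Separating : {I A : Set} → (I → A → Set) → Set
Separating {I} {A} T = (∀ a → ∃[ i ] T i a) × (∀ {a b} → (∀ i → T i a ⇔ T i b) → a ≡ b)

-- `1 ≤ r` makes every selection nonempty, so it passes a test at one of its points; the next level
-- relies on this.
selection-separating : ∀ {I A : Set} {T : I → A → Set} → Separating T → ∀ {n r} → 1 ≤ r →
  Separating {I × Fin n} {Selection A n r} (λ (i , x) c → Selects (T i) c x)
selection-separating {I} {A} {T} (inhabited , separated) 1≤r = inhabited′ 1≤r , separated′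
  where
  inhabited′ : ∀ {n r} → 1 ≤ r → (c : Selection A n r) → ∃ λ ((i , x) : I × Fin n) → Selects (T i) c x
  inhabited′ 1≤r (a ∷ c)  = (proj₁ (inhabited a) , zero) , proj₂ (inhabited a)
  inhabited′ 1≤r (skip c) = let (i , x) , t = inhabited′ 1≤r c in (i , suc x) , t

  separated′ : ∀ {n r} {c c′ : Selection A n r} →
    (∀ ((i , x) : I × Fin n) → Selects (T i) c x ⇔ Selects (T i) c′ x) → c ≡ c′
  separated′ {c = []}     {[]}      _  = refl
  separated′ {c = a ∷ c}  {b ∷ c′}  eq =
    cong₂ _∷_ (separated (λ i → eq (i , zero))) (separated′ (λ (i , x) → eq (i , suc x)))
  separated′ {c = a ∷ c}  {skip c′} eq = ⊥-elim (to (eq (_ , zero)) (proj₂ (inhabited a)))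
  separated′ {c = skip c} {b ∷ c′}  eq = ⊥-elim (from (eq (_ , zero)) (proj₂ (inhabited b)))
  separated′ {c = skip c} {skip c′} eq = cong skip (separated′ (λ (i , x) → eq (i , suc x)))

labelled-separating : ∀ {s} (e r : Fin s → ℕ) → Bounds e r → ∀ {I A : Set} {T : I → A → Set} →
  Separating T → ∀ {X Y : Labelled e r A} → (∀ i p → Hit e r (T i) X p ⇔ Hit e r (T i) Y p) → X ≡ Y
labelled-separating {zero} e r _ (_ , separated) eq = separated (λ i → eq i tt)
labelled-separating {suc s} e r bounds sep eq =
  labelled-separating (e ∘ suc) (r ∘ suc) (bounds ∘ suc)
    (selection-separating sep (<⇒≤ (proj₁ (bounds zero)))) (λ (i , x) p → eq i (x , p))

-- Transitivity on points and on flags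

transpose-preserves : ∀ {n} (P : Fin n → Set) {i j k} → P i → P j → P k → P (PC.transpose i j k)
transpose-preserves P {i} {j} {k} pi pj pk with does (k Fin.≟ i)
... | true = pj
... | false with does (k Fin.≟ j)
...   | true  = pi
...   | false = pk

transpose-at : ∀ {n} (i j : Fin n) → transpose i j ⟨$⟩ʳ i ≡ j
transpose-at i j with i Fin.≟ i
... | yes _  = refl
... | no i≢i = contradiction refl i≢i

-- Serves twice: for arbitrary points it gives transitivity on all points, for points of the box
-- also stabilisation of the box. The inverse is included because equality of the box with its image
-- needs both inclusions.
coordinatewise-transposition : ∀ {s} (e r : Fin s → ℕ) γ δ →
  Σ[ g ∈ Sym (∏ℤ e) ] g ∈ Wreath e × γ ^ g ᵖ ≡ δ ×
  (γ ∈ Box e r → δ ∈ Box e r → ∀ {p} → p ∈ Box e r → p ^ g ᵖ ∈ Box e r × p ^ ↔-sym g ᵖ ∈ Box e r)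
coordinatewise-transposition {zero} e r γ δ =
  ↔-refl , IsPermutationGroup.identity (wreath-isPermutationGroup e) , refl , λ _ _ _ → (λ ()) , (λ ())
coordinatewise-transposition {suc s} e r (x , γ) (y , δ) =
  let g , g∈W , γg≡δ , preserves = coordinatewise-transposition (e ∘ suc) (r ∘ suc) γ δ
      h = const (transpose x y)
  in h ⋉ g , ⋉-∈-Wreath e h {g} g∈W , cong₂ _,_ (transpose-at x y) γg≡δ ,
     λ γ∈ δ∈ {p} p∈ →
       let p-to , p-from = preserves (γ∈ ∘ suc) (δ∈ ∘ suc) (p∈ ∘ suc)
           P = λ z → toℕ z < r zero
       in (λ { zero → transpose-preserves P {k = proj₁ p} (γ∈ zero) (δ∈ zero) (p∈ zero) ; (suc j) → p-to j })
        , (λ { zero → transpose-preserves P {k = proj₁ p} (δ∈ zero) (γ∈ zero) (p∈ zero) ; (suc j) → p-from j })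

module _ {P : Set} where

  ^ˢ-cong : ∀ {X Y : Subset P} g → X ≐ Y → X ^ g ˢ ≐ Y ^ g ˢ
  ^ˢ-cong g (X⊆Y , Y⊆X) = map₂ (map₁ X⊆Y) , map₂ (map₁ Y⊆X)

  ^ˢ-∘ : ∀ (X : Subset P) g h → X ^ (h ↔-∘ g) ˢ ≐ (X ^ g ˢ) ^ h ˢ
  ^ˢ-∘ X g h = (λ { (α , α∈X , eq) → α ^ g ᵖ , (α , α∈X , refl) , eq })
             , (λ { (_ , (α , α∈X , refl) , eq) → α , α∈X , eq })

  ^ˢ-inverse : ∀ (X : Subset P) g → (X ^ g ˢ) ^ ↔-sym g ˢ ≐ X
  ^ˢ-inverse X g =
      (λ { (_ , (α , α∈X , refl) , refl) → subst X (sym (Inverse.strictlyInverseʳ g α)) α∈X })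
    , (λ {α} α∈X → α ^ g ᵖ , (α , α∈X , refl) , Inverse.strictlyInverseʳ g α)

  module _ {G : Pred (Sym P) _} (isGroup : IsPermutationGroup G) (B : Subset P) where
    open IsPermutationGroup isGroup

    orbit-isGroupOfAutomorphisms : IsGroupOfAutomorphisms G (Orbit B G)
    orbit-isGroupOfAutomorphisms = record
      { isPermutationGroup = isGroup
      ; automorphism = λ {g} g∈G X → mk⇔ (image g∈G X) λ X^g∈ →
          orbit-respects (^ˢ-inverse X g) (image (inverse g∈G) (X ^ g ˢ) X^g∈)
      }
      where
      orbit-respects : ∀ {X Y} → X ≐ Y → X ∈ Orbit B G → Y ∈ Orbit B G
      orbit-respects X≐Y (h , h∈G , X≐B^h) = h , h∈G , ≐.≐-trans (≐.≐-sym X≐Y) X≐B^h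

      image : ∀ {g} → g ∈ G → ∀ X → X ∈ Orbit B G → X ^ g ˢ ∈ Orbit B G
      image {g} g∈G X (h , h∈G , X≐B^h) = g ↔-∘ h , closed g∈G h∈G ,
        ≐.≐-trans (^ˢ-cong g X≐B^h) (≐.≐-sym (^ˢ-∘ B h g))

    orbit-isFlagTransitive :
      (∀ {γ δ} → γ ∈ B → δ ∈ B → ∃[ t ] t ∈ G × γ ^ t ᵖ ≡ δ × B ^ t ˢ ≐ B) →
      IsFlagTransitive G (Orbit B G)
    orbit-isFlagTransitive stabiliser-transitive = record
      { isGroupOfAutomorphisms = orbit-isGroupOfAutomorphisms
      ; transitive = transitive
      }
      where
      transitive : ∀ {α β X Y} → X ∈ Orbit B G → α ∈ X → Y ∈ Orbit B G → β ∈ Y →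
                   ∃[ g ] g ∈ G × α ^ g ᵖ ≡ β × X ^ g ˢ ≐ Y
      transitive {X = X} {Y} (g , g∈G , X≐B^g) α∈X (h , h∈G , Y≐B^h) β∈Y
        with proj₁ X≐B^g α∈X | proj₁ Y≐B^h β∈Y
      ... | γ , γ∈B , refl | δ , δ∈B , refl =
        let t , t∈G , γt≡δ , B^t≐B = stabiliser-transitive γ∈B δ∈B
        -- Back from the first block to `B`, then within `B`, then out to the second block.
        in h ↔-∘ (t ↔-∘ ↔-sym g) , closed h∈G (closed t∈G (inverse g∈G)) ,
           cong (_^ h ᵖ) (trans (cong (_^ t ᵖ) (Inverse.strictlyInverseʳ g γ)) γt≡δ) ,
           ≐.≐-trans (^ˢ-∘ X (t ↔-∘ ↔-sym g) h) (≐.≐-trans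
             (^ˢ-cong h (≐.≐-trans (^ˢ-∘ X (↔-sym g) t) (≐.≐-trans
               (^ˢ-cong t (≐.≐-trans (^ˢ-cong (↔-sym g) X≐B^g) (^ˢ-inverse B g)))
               B^t≐B)))
             (≐.≐-sym Y≐B^h))

-- The orbit of a box as a design

Selects-irrelevant : ∀ {A : Set} {F : A → Set} → (∀ a → Irrelevant (F a)) →
                     ∀ {n r} (c : Selection A n r) x → Irrelevant (Selects F c x)
Selects-irrelevant irr (a ∷ c)  zero    = irr a
Selects-irrelevant irr (a ∷ c)  (suc x) = Selects-irrelevant irr c x
Selects-irrelevant irr (skip c) zero    ()
Selects-irrelevant irr (skip c) (suc x) = Selects-irrelevant irr c x

-- Codes paired with membership proofs are then equal as soon as the codes are, so counting the
-- pairs counts codes.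
Hit-irrelevant : ∀ {s} (e r : Fin s → ℕ) {A : Set} {F : A → Set} → (∀ a → Irrelevant (F a)) →
                 ∀ X p → Irrelevant (Hit e r F X p)
Hit-irrelevant {zero}  e r irr X _       = irr X
Hit-irrelevant {suc s} e r irr X (x , p) =
  Hit-irrelevant (e ∘ suc) (r ∘ suc) (λ c → Selects-irrelevant irr c x) X p

embed : ∀ {s} (e r : Fin s → ℕ) → (∀ j → r j ≤ e j) → ∏ℤ r → ∏ℤ e
embed {zero}  e r r≤e _       = tt
embed {suc s} e r r≤e (x , p) = inject≤ x (r≤e zero) , embed (e ∘ suc) (r ∘ suc) (r≤e ∘ suc) p

embed-∈-Box : ∀ {s} (e r : Fin s → ℕ) r≤e p → embed e r r≤e p ∈ Box e r
embed-∈-Box e r r≤e (x , p) zero    = subst (_< r zero) (sym (toℕ-inject≤ x (r≤e zero))) (toℕ<n x)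
embed-∈-Box e r r≤e (x , p) (suc j) = embed-∈-Box (e ∘ suc) (r ∘ suc) (r≤e ∘ suc) p j

embed-injective : ∀ {s} (e r : Fin s → ℕ) r≤e {p q} → embed e r r≤e p ≡ embed e r r≤e q → p ≡ q
embed-injective {zero}  e r r≤e _ = refl
embed-injective {suc s} e r r≤e {x , _} {y , _} eq = cong₂ _,_
  (Fin.inject≤-injective (r≤e zero) (r≤e zero) x y (cong proj₁ eq))
  (embed-injective (e ∘ suc) (r ∘ suc) (r≤e ∘ suc) (cong proj₂ eq))

restrict : ∀ {s} (e r : Fin s → ℕ) {p} → p ∈ Box e r → ∏ℤ r
restrict {zero}  e r p∈ = tt
restrict {suc s} e r p∈ = fromℕ< (p∈ zero) , restrict (e ∘ suc) (r ∘ suc) (p∈ ∘ suc)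

embed-restrict : ∀ {s} (e r : Fin s → ℕ) r≤e {p} (p∈ : p ∈ Box e r) → embed e r r≤e (restrict e r p∈) ≡ p
embed-restrict {zero}  e r r≤e p∈ = refl
embed-restrict {suc s} e r r≤e p∈ = cong₂ _,_
  (toℕ-injective (trans (toℕ-inject≤ _ (r≤e zero)) (toℕ-fromℕ< (p∈ zero))))
  (embed-restrict (e ∘ suc) (r ∘ suc) (r≤e ∘ suc) (p∈ ∘ suc))

module BoxOrbit {s} (e r : Fin s → ℕ) (bounds : Bounds e r) where

  𝓑 : Pred (Subset (∏ℤ e)) _
  𝓑 = Orbit (Box e r) (Wreath e)

  -- Labels in the unit type carry no information, so this is a plain block. Codes for the same set
  -- of points are propositionally equal, which makes them countable.
  Code : Set
  Code = Labelled e r ⊤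

  ⟦_⟧ : Code → Subset (∏ℤ e)
  ⟦ X ⟧ = Hit e r (λ _ → ⊤) X

  encodes⇒≐ : ∀ g ℓ X → Encodes e r g ℓ X → ⟦ X ⟧ ≐ Box e r ^ g ˢ
  encodes⇒≐ g ℓ X enc =
      (λ {β} hit → β ^ ↔-sym g ᵖ
                 , proj₁ (to (enc _ _) (subst ⟦ X ⟧ (sym (Inverse.strictlyInverseˡ g β)) hit))
                 , Inverse.strictlyInverseˡ g β)
    , (λ { (α , α∈ , refl) → from (enc _ α) (α∈ , tt) })

  ⟦⟧-∈-𝓑 : ∀ X → ⟦ X ⟧ ∈ 𝓑
  ⟦⟧-∈-𝓑 X = let g , g∈W , ℓ , enc = permutation-encoded e r bounds tt X in g , g∈W , encodes⇒≐ g ℓ X enc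

  code : ∀ {X} → X ∈ 𝓑 → ∃[ c ] ⟦ c ⟧ ≐ X
  code (g , g∈W , X≐) =
    let c , enc = encode e r bounds g g∈W (const tt) in c , ≐.≐-trans (encodes⇒≐ g (const tt) c enc) (≐.≐-sym X≐)

  ⟦⟧-injective : ∀ {X Y} → ⟦ X ⟧ ≐ ⟦ Y ⟧ → X ≡ Y
  ⟦⟧-injective (X⊆Y , Y⊆X) =
    labelled-separating e r bounds {I = ⊤} {T = λ _ _ → ⊤} ((λ _ → tt , tt) , λ _ → refl) (λ _ p → mk⇔ X⊆Y Y⊆X)

  blockSize : ∀ {X} → X ∈ 𝓑 → HasSize (setoid (∏ℤ e)) X (∏ r)
  blockSize {X} (g , _ , X⊆ , ⊆X) = record
    { to = λ i → point i , ⊆X (_ , embed-∈-Box e r r≤e _ , refl)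
    ; from = λ { (_ , β∈X) → index β∈X }
    ; to-cong = cong point
    ; from-cong = λ { {_ , β∈X} {_ , β∈X′} refl → index-unique β∈X (point-index β∈X′) }
    ; inverse = (λ { {_ , β∈X} refl → point-index β∈X }) , (λ { {_} {_ , β∈X} refl → index-unique β∈X refl })
    }
    where
    r≤e = proj₂ ∘ bounds
    point : Fin (∏ r) → ∏ℤ e
    point i = embed e r r≤e (Inverse.to (∏ℤ-↔ r) i) ^ g ᵖ

    index : ∀ {β} → β ∈ X → Fin (∏ r)
    index β∈X = Inverse.from (∏ℤ-↔ r) (restrict e r (proj₁ (proj₂ (X⊆ β∈X))))

    point-index : ∀ {β} (β∈X : β ∈ X) → point (index β∈X) ≡ β
    point-index β∈X with X⊆ β∈X
    ... | _ , α∈ , refl = cong (_^ g ᵖ) (trans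
      (cong (embed e r r≤e) (Inverse.strictlyInverseˡ (∏ℤ-↔ r) _)) (embed-restrict e r r≤e α∈))

    index-unique : ∀ {β} (β∈X : β ∈ X) {i} → point i ≡ β → index β∈X ≡ i
    index-unique β∈X eq = Injection.injective (↔⇒↣ (∏ℤ-↔ r)) (embed-injective e r r≤e
      (Injection.injective (↔⇒↣ g) (trans (point-index β∈X) (sym eq))))

  -- `code` and `⟦_⟧` are mutually inverse, up to `≐` on the side of subsets, so blocks are counted
  -- by their codes.
  blocks-through : ∀ {α β m} → Fin m ↔ Σ Code (λ X → α ∈ ⟦ X ⟧ × β ∈ ⟦ X ⟧) →
                   HasSize (≐-setoid (∏ℤ e) _) (λ X → X ∈ 𝓑 × α ∈ X × β ∈ X) m
  blocks-through {α} {β} m↔ = record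
    { to = λ i → let X , hits = m.to i in ⟦ X ⟧ , ⟦⟧-∈-𝓑 X , hits
    ; from = m.from ∘ codes
    ; to-cong = λ { refl → ≐.≐-refl }
    ; from-cong = λ {X} {Y} X≐Y → cong m.from (codes-unique X (≐.≐-trans X≐Y (≐.≐-sym (codes-≐ Y))))
    ; inverse = (λ { {X} refl → subst (λ c → ⟦ proj₁ c ⟧ ≐ proj₁ X)
                                  (sym (m.strictlyInverseˡ (codes X))) (codes-≐ X) })
              , (λ {i} {X} X≐ → trans (cong m.from (codes-unique X X≐)) (m.strictlyInverseʳ i))
    }
    where
    module m = Inverse m↔
    Blocks = Σ (Subset (∏ℤ e)) (λ X → X ∈ 𝓑 × α ∈ X × β ∈ X)

    codes : Blocks → Σ Code (λ X → α ∈ ⟦ X ⟧ × β ∈ ⟦ X ⟧)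
    codes (X , X∈𝓑 , α∈X , β∈X) = let c , _ , X⊆ = code X∈𝓑 in c , X⊆ α∈X , X⊆ β∈X

    codes-≐ : ∀ X → ⟦ proj₁ (codes X) ⟧ ≐ proj₁ X
    codes-≐ (X , X∈𝓑 , _) = proj₂ (code X∈𝓑)

    code-≡ : {c c′ : Σ Code (λ X → α ∈ ⟦ X ⟧ × β ∈ ⟦ X ⟧)} → proj₁ c ≡ proj₁ c′ → c ≡ c′
    code-≡ {c , _} refl = cong (c ,_) (cong₂ _,_ (irrelevant α _ _) (irrelevant β _ _))
      where
      irrelevant : ∀ p → Irrelevant (p ∈ ⟦ c ⟧)
      irrelevant = Hit-irrelevant e r (λ _ _ _ → refl) c

    codes-unique : ∀ X {c} → proj₁ X ≐ ⟦ proj₁ c ⟧ → codes X ≡ c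
    codes-unique X {c} X≐ = code-≡ (⟦⟧-injective {proj₁ (codes X)} {proj₁ c} (≐.≐-trans (codes-≐ X) X≐))

  isFlagTransitive : IsFlagTransitive (Wreath e) 𝓑
  isFlagTransitive = orbit-isFlagTransitive (wreath-isPermutationGroup e) (Box e r) λ {γ} {δ} γ∈ δ∈ →
    let t , t∈W , γt≡δ , preserves = coordinatewise-transposition e r γ δ
    in t , t∈W , γt≡δ ,
       (λ { (p , p∈ , refl) → proj₁ (preserves γ∈ δ∈ p∈) }) ,
       (λ {p} p∈ → p ^ ↔-sym t ᵖ , proj₂ (preserves γ∈ δ∈ p∈) , Inverse.strictlyInverseˡ t p)

  isChainImprimitive : IsChainImprimitive e (Wreath e) 𝓑
  isChainImprimitive = record
    { isGroupOfAutomorphisms = IsFlagTransitive.isGroupOfAutomorphisms isFlagTransitive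
    ; transitive = λ α β → let g , g∈W , eq , _ = coordinatewise-transposition e r α β in g , g∈W , eq
    ; invariant = λ g∈W → g∈W
    }

  -- The number of blocks through any pair satisfies one and the same equation, whose factor
  -- `∏ e * d` is positive. So λ can be taken from a single pair.
  is2Design : ∀ {d} → 1 ≤ d → Balance d 1 1 e r → 2 ≤ ∏ e →
    ∃[ l ] l * (∏ e * d) ≡ #labelled e r 1 * ∏ r × Is2Design 𝓑 (∏ e) (∏ r) l
  is2Design {d} 1≤d balance 2≤v = l , l-eq , record
    { respects = λ { X≐Y (g , g∈W , X≐) → g , g∈W , ≐.≐-trans (≐.≐-sym X≐Y) X≐ }
    ; points = ∏ℤ-↔ e
    ; nonempty = Box e r , ↔-refl , IsPermutationGroup.identity (wreath-isPermutationGroup e) ,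
        (λ p∈ → _ , p∈ , refl) , (λ { (_ , p∈ , refl) → p∈ })
    ; blockSize = blockSize
    ; balanced = λ α≢β → let m , m↔ , m-eq = through α≢β in
        blocks-through (resize (*-cancelʳ-≡ m l (∏ e * d) {{v*d≢0}} (trans m-eq (sym l-eq))) m↔)
    }
    where
    v*d≢0 : NonZero (∏ e * d)
    v*d≢0 = >-nonZero (*-mono-≤ (<⇒≤ 2≤v) 1≤d)

    through : ∀ {α β} → α ≢ β → CountWith (Σ Code (λ X → α ∈ ⟦ X ⟧ × β ∈ ⟦ X ⟧)) λ m →
              m * (∏ e * d) ≡ #labelled e r 1 * ∏ r
    through α≢β =
      -- No coordinate is split off yet, hence α = β = 1, and there is a single label.
      let m , m↔ , eq = hit₂-count d 1 1 e r bounds balance z<s 1↔⊤ Σ⊤ Σ⊤ α≢β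
      in m , m↔ , subst₂ _≡_
           (cong (λ z → m * (∏ e * z)) (trans (*-identityʳ (1 * d)) (*-identityˡ d)))
           (cong (#labelled e r 1 *_) (*-identityʳ (∏ r))) eq
      where
      Σ⊤ : Fin 1 ↔ Σ ⊤ (λ _ → ⊤)
      Σ⊤ = ↔-trans 1↔⊤ (mk↔ₛ′ (λ _ → _) (λ _ → tt) (λ _ → refl) (λ _ → refl))

    -- The points numbered 0 and 1 are the pair that defines λ.
    distinct : Inverse.to (∏ℤ-↔ e) (fromℕ< (<⇒≤ 2≤v)) ≢ Inverse.to (∏ℤ-↔ e) (fromℕ< 2≤v)
    distinct eq = 0≢1+n (trans (sym (toℕ-fromℕ< (<⇒≤ 2≤v)))
      (trans (cong toℕ (Injection.injective (↔⇒↣ (∏ℤ-↔ e)) eq)) (toℕ-fromℕ< 2≤v)))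

    l : ℕ
    l = proj₁ (through distinct)

    l-eq : l * (∏ e * d) ≡ #labelled e r 1 * ∏ r
    l-eq = proj₂ (proj₂ (through distinct))

-- Telescoping products

∏-telescope : ∀ s (α ρ : ℕ → ℕ) → (∀ i → α (suc i) ≡ α i * ρ i) →
              α 0 * ∏ {s} (ρ ∘ toℕ) ≡ α s
∏-telescope zero    α ρ step = *-identityʳ (α 0)
∏-telescope (suc s) α ρ step = begin
  α 0 * (ρ 0 * ∏ {s} (ρ ∘ suc ∘ toℕ))   ≡⟨ *-assoc (α 0) (ρ 0) _ ⟨
  α 0 * ρ 0 * ∏ {s} (ρ ∘ suc ∘ toℕ)     ≡⟨ cong (_* ∏ {s} (ρ ∘ suc ∘ toℕ)) (step 0) ⟨
  α 1 * ∏ {s} (ρ ∘ suc ∘ toℕ)           ≡⟨ ∏-telescope s (α ∘ suc) (ρ ∘ suc) (step ∘ suc) ⟩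
  α (suc s)                             ∎
  where open ≡-Reasoning

-- For the ratios this is k / y_i with i the successor of `j`: the number of 𝒞ᵢ-classes that meet a
-- block, in each of which children are chosen.
∏> : ∀ {s} → (Fin s → ℕ) → Fin s → ℕ
∏> r zero    = ∏ (r ∘ suc)
∏> r (suc j) = ∏> (r ∘ suc) j

∏>-telescope : ∀ s (α ρ : ℕ → ℕ) → (∀ i → α (suc i) ≡ α i * ρ i) →
               ∀ (j : Fin s) → α (suc (toℕ j)) * ∏> (ρ ∘ toℕ) j ≡ α s
∏>-telescope (suc s) α ρ step zero    = ∏-telescope s (α ∘ suc) (ρ ∘ suc) (step ∘ suc)
∏>-telescope (suc s) α ρ step (suc j) = ∏>-telescope s (α ∘ suc) (ρ ∘ suc) (step ∘ suc) j

balance-telescope : ∀ s d (α β ρ ε : ℕ → ℕ) → (∀ i → α (suc i) ≡ α i * ρ i) →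
  (∀ i → β (suc i) ≡ β i * ε i) →
  (∀ i → α i * (ρ i ∸ 1) * d ≡ β i * (ε i ∸ 1)) → Balance {s} d (α 0) (β 0) (ε ∘ toℕ) (ρ ∘ toℕ)
balance-telescope zero    d α β ρ ε _ _ _ = tt
balance-telescope (suc s) d α β ρ ε α-step β-step eq = eq 0 ,
  subst₂ (λ a b → Balance {s} d a b (ε ∘ suc ∘ toℕ) (ρ ∘ suc ∘ toℕ)) (α-step 0) (β-step 0)
    (balance-telescope s d (α ∘ suc) (β ∘ suc) (ρ ∘ suc) (ε ∘ suc) (α-step ∘ suc) (β-step ∘ suc) (eq ∘ suc))

#labelled-product : ∀ {s} (e r : Fin s → ℕ) →
  #labelled e r 1 ≡ product (tabulate λ j → (e j C r j) ^ ∏> r j)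
#labelled-product {zero}  e r = refl
#labelled-product {suc s} e r = begin
  #labelled (e ∘ suc) (r ∘ suc) (c * 1 ^ r zero)  ≡⟨ cong (#labelled (e ∘ suc) (r ∘ suc))
                                                          (trans (cong (c *_) (^-zeroˡ (r zero))) (*-identityʳ c)) ⟩
  #labelled (e ∘ suc) (r ∘ suc) c                 ≡⟨ #labelled-closed (e ∘ suc) (r ∘ suc) c ⟩
  c ^ ∏ (r ∘ suc) * #labelled (e ∘ suc) (r ∘ suc) 1 ≡⟨ cong (c ^ ∏ (r ∘ suc) *_)
                                                          (#labelled-product (e ∘ suc) (r ∘ suc)) ⟩
  product (tabulate λ j → (e j C r j) ^ ∏> r j)   ∎
  where
  open ≡-Reasoning
  c = e zero C r zero

-- Arithmetic of the parameters

module Parameters (s d : ℕ) (2≤s : 2 ≤ s) (2≤d : 2 ≤ d) where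
  open Construction s d 2≤s 2≤d

  -- The value e₁ fits the general recursion because the empty product is 1.
  e≡d+∏e : ∀ i → e₊₁ i ≡ d + ∏e i
  e≡d+∏e zero    = refl
  e≡d+∏e (suc i) = refl

  -- A division-free form of `y`, as the product of the ratios; `y≡Y` identifies the two.
  Y : ℕ → ℕ
  Y zero    = 1
  Y (suc i) = Y i * suc (∏e i)

  -- The exact quotient of `∏e i ∸ 1` by `d`.
  z : ℕ → ℕ
  z i = pred (Y i)

  Y≡1+z : ∀ i → Y i ≡ suc (z i)
  Y≡1+z i = sym (suc-pred (Y i) {{>-nonZero (0<Y i)}})
    where
    0<Y : ∀ i → 0 < Y i
    0<Y zero    = z<s
    0<Y (suc i) = *-mono-≤ (0<Y i) (s≤s z≤n)

  -- Multiplying Y by 1 + E turns d Y + 1 into d + E (d Y + 1), and d Y + 1 is the next e, which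
  -- extends the product E.
  Y*d+1 : ∀ i → Y i * d + 1 ≡ d + ∏e i
  Y*d+1 zero    = cong (_+ 1) (*-identityˡ d)
  Y*d+1 (suc i) = begin
    Y i * suc E * d + 1           ≡⟨ expand (Y i) E d ⟩
    (Y i * d + 1) + Y i * d * E   ≡⟨ cong (_+ Y i * d * E) (Y*d+1 i) ⟩
    d + E + Y i * d * E           ≡⟨ regroup d E (Y i * d) ⟩
    d + E * (Y i * d + 1)         ≡⟨ cong (λ t → d + E * t) (trans (Y*d+1 i) (sym (e≡d+∏e i))) ⟩
    d + E * e₊₁ i                 ∎
    where
    open ≡-Reasoning
    E = ∏e i
    expand : ∀ y E d → y * suc E * d + 1 ≡ (y * d + 1) + y * d * E
    expand = solve-∀
    regroup : ∀ d E t → d + E + t * E ≡ d + E * (t + 1)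
    regroup = solve-∀

  Y*d : ∀ i → Y i * d ≡ e₊₁ i ∸ 1
  Y*d i = sym (trans (cong (_∸ 1) (trans (e≡d+∏e i) (sym (Y*d+1 i)))) (m+n∸n≡m (Y i * d) 1))

  ∏e∸1 : ∀ i → ∏e i ∸ 1 ≡ z i * d
  ∏e∸1 i = trans (cong (_∸ 1) ∏e≡) (m+n∸n≡m (z i * d) 1)
    where
    ∏e≡ : ∏e i ≡ z i * d + 1
    ∏e≡ = +-cancelˡ-≡ d _ _ (begin
      d + ∏e i              ≡⟨ Y*d+1 i ⟨
      Y i * d + 1           ≡⟨ cong (λ t → t * d + 1) (Y≡1+z i) ⟩
      d + z i * d + 1       ≡⟨ +-assoc d (z i * d) 1 ⟩
      d + (z i * d + 1)     ∎)
      where open ≡-Reasoning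

  d∣v∸1 : d ∣ (v ∸ 1)
  d∣v∸1 = divides (z s) (∏e∸1 s)

  k∸1≡z : k ∸ 1 ≡ z s
  k∸1≡z = trans (/-congˡ (∏e∸1 s)) (m*n/n≡m (z s) d)

  k≡Y : k ≡ Y s
  k≡Y = trans (cong suc k∸1≡z) (sym (Y≡1+z s))

  -- As k - 1 = z_s and v - 1 = z_s d, the factor d only changes sides, so the quotient in `y` is
  -- exactly z_i.
  y-numerator : ∀ i → (k ∸ 1) * (∏e i ∸ 1) ≡ z i * (v ∸ 1)
  y-numerator i = begin
    (k ∸ 1) * (∏e i ∸ 1)  ≡⟨ cong₂ _*_ k∸1≡z (∏e∸1 i) ⟩
    z s * (z i * d)       ≡⟨ shuffle (z s) (z i) d ⟩
    z i * (z s * d)       ≡⟨ cong (z i *_) (∏e∸1 s) ⟨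
    z i * (v ∸ 1)         ∎
    where
    open ≡-Reasoning
    shuffle : ∀ a b d → a * (b * d) ≡ b * (a * d)
    shuffle = solve-∀

  y≡Y : ∀ i → y i ≡ Y i
  y≡Y zero      = refl
  y≡Y i@(suc _) = trans (cong suc (trans (/-congˡ (y-numerator i)) (m*n/n≡m (z i) (v ∸ 1)))) (sym (Y≡1+z i))

  y-step : ∀ i → y (suc i) ≡ suc (∏e i) * y i
  y-step i = trans (y≡Y (suc i)) (trans (*-comm (Y i) (suc (∏e i))) (cong (suc (∏e i) *_) (sym (y≡Y i))))

  ratio≡1+∏e : ∀ j → ratio j ≡ suc (∏e j)
  ratio≡1+∏e j = trans (/-congˡ {{y-nonZero j}} (y-step j)) (m*n/n≡m (suc (∏e j)) (y j) {{y-nonZero j}})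

  y-ratio : ∀ i → y (suc i) ≡ y i * ratio i
  y-ratio i = trans (y-step i) (trans (*-comm _ (y i)) (cong (y i *_) (sym (ratio≡1+∏e i))))

  y*d : ∀ i → y i * d ≡ e₊₁ i ∸ 1
  y*d i = trans (cong (_* d) (y≡Y i)) (Y*d i)

  ys≡k : y s ≡ k
  ys≡k = trans (y≡Y s) (sym k≡Y)

  r : Fin s → ℕ
  r = ratio ∘ toℕ

  y∣k : ∀ i → 1 ≤ i → i ≤ s → y i ∣ k
  y∣k i _ i≤s = subst (y i ∣_) ys≡k (go (≤⇒≤′ i≤s))
    where
    go : ∀ {n} → i ≤′ n → y i ∣ y n
    go ≤′-refl       = ∣-refl
    go (≤′-step {n} i≤n) = ∣-trans (go i≤n) (divides (suc (∏e n)) (y-step n))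

  bounds : Bounds e r
  bounds j rewrite ratio≡1+∏e (toℕ j) | e≡d+∏e (toℕ j) =
    -- With E the product of the earlier e_j, this is 2 ≤ 1 + E and 1 + E ≤ d + E.
    s≤s (1≤∏e (toℕ j)) , +-monoˡ-≤ (∏e (toℕ j)) (≤-trans (s≤s z≤n) 2≤d)

  -- The ratio minus 1 equals the current β, so each condition reduces to `y*d`.
  balance : Balance d 1 1 e r
  balance = balance-telescope s d y ∏e ratio e₊₁ y-ratio (λ _ → refl) λ i → begin
    y i * (ratio i ∸ 1) * d   ≡⟨ cong (λ t → y i * (t ∸ 1) * d) (ratio≡1+∏e i) ⟩
    y i * ∏e i * d            ≡⟨ shuffle (y i) (∏e i) d ⟩
    ∏e i * (y i * d)          ≡⟨ cong (∏e i *_) (y*d i) ⟩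
    ∏e i * (e₊₁ i ∸ 1)        ∎
    where
    open ≡-Reasoning
    shuffle : ∀ a b d → a * b * d ≡ b * (a * d)
    shuffle = solve-∀

  ∏e≡v : ∏ e ≡ v
  ∏e≡v = trans (sym (*-identityˡ _)) (∏-telescope s ∏e e₊₁ (λ _ → refl))

  ∏r≡k : ∏ r ≡ k
  ∏r≡k = trans (sym (*-identityˡ _)) (trans (∏-telescope s y ratio y-ratio) ys≡k)

  #blocks≡b : #labelled e r 1 ≡ b
  #blocks≡b = trans (#labelled-product e r) (cong product (tabulate-cong λ j →
    -- As k is y_s, it telescopes into y at the next index times the later ratios, so the exponent
    -- in `b` is an exact quotient.
    cong ((e j C r j) ^_) (sym (trans
      (/-congˡ (trans (sym ys≡k) (trans (sym (∏>-telescope s y ratio y-ratio j)) (*-comm (y (suc (toℕ j))) _))))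
      (m*n/n≡m (∏> r j) (y (suc (toℕ j))))))))

-- The four divisibility clauses certify that the rounded quotients in `k`, `y`, `ratio` and the
-- exponents of `b` are exact. Since v d is positive, the equation for `l` says that b k / (v d) is
-- an integer and equals `l`.
proposition6p2 : ∀ (s d : ℕ) (2≤s : 2 ≤ s) (2≤d : 2 ≤ d) →
    let open Construction s d 2≤s 2≤d in
    d ∣ (v ∸ 1) ×
    (∀ i → 1 ≤ i → i ≤ s → (v ∸ 1) ∣ ((k ∸ 1) * (∏e i ∸ 1))) ×
    (∀ i → i < s → y i ∣ y (suc i)) ×
    (∀ i → 1 ≤ i → i ≤ s → y i ∣ k) ×
    (∃[ l ] l * (v * d) ≡ b * k × Is2Design B^G v k l) ×
    IsFlagTransitive G B^G ×
    IsChainImprimitive e G B^G ×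
    (∀ i → 1 ≤ i → i ≤ s ∸ 1 → y i * d ≡ e₊₁ i ∸ 1) ×
    y s ≡ k
proposition6p2 s d 2≤s 2≤d =
  d∣v∸1 ,
  (λ i _ _ → divides (z i) (y-numerator i)) ,
  (λ i _ → divides (suc (∏e i)) (y-step i)) ,
  y∣k ,
  design ,
  isFlagTransitive ,
  isChainImprimitive ,
  (λ i _ _ → y*d i) ,
  ys≡k
  where
  open Construction s d 2≤s 2≤d
  open Parameters s d 2≤s 2≤d
  open BoxOrbit e r bounds

  2≤∏ : 2 ≤ ∏ e
  2≤∏ = subst (2 ≤_) (sym ∏e≡v) (2≤∏e (≤-trans (s≤s z≤n) 2≤s))

  design : ∃[ l ] l * (v * d) ≡ b * k × Is2Design B^G v k l
  design =
    let l , l-eq , D = is2Design (≤-trans (s≤s z≤n) 2≤d) balance 2≤∏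
    in l , trans (cong (λ t → l * (t * d)) (sym ∏e≡v)) (trans l-eq (cong₂ _*_ #blocks≡b ∏r≡k)) ,
       subst₂ (λ v k → Is2Design B^G v k l) ∏e≡v ∏r≡k D
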